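{- Let $n\ge 2$ be an integer. The identity map is the unique order-preserving automorphism of the poset $\mathrm{Poset}(\mathrm{PF}_{n,n})$.
   Context: An order-preserving automorphism of a poset is a bijection $f$ from the poset to itself with $x\le y$ if and only if $f(x)\le f(y)$. Write $[n]=\{1,\dots,n\}$. A parking function of length $n$ is an $n$-tuple $(a_1,\dots,a_n)$ of positive integers whose weakly increasing rearrangement $b_1\le\dots\le b_n$ satisfies $b_i\le i$ for all $i$; $\mathrm{PF}_n$ is the set of these. For $n\ge 2$, $\mathrm{PF}_{n,n}$ is the set of $a\in\mathrm{PF}_n$ such that $n$ is not an entry of $a$. $\mathrm{NC}_m$ is the lattice of noncrossing partitions of $[m]$ (partitions for which, placing $1,\dots,m$ in clockwise order on a circle, the convex hulls of the blocks are pairwise disjoint), ordered by refinement, with the finer partition being smaller. Each covering relation $\sigma<\tau$ in $\mathrm{NC}_{n+1}$ merges two blocks $B_1,B_2$ of $\sigma$ into one block $B=B_1\cup B_2$ of $\tau$; name them so that $\min B\in B_1$, and label the covering relation by the largest element of $B_1$ that is less than every element of $B_2$. Reading the labels of a maximal chain of $\mathrm{NC}_{n+1}$ from bottom to top gives a parking function of length $n$, and this is a (known) bijection from maximal chains of $\mathrm{NC}_{n+1}$ to $\mathrm{PF}_n$. $\mathrm{Poset}(\mathrm{PF}_{n,n})$ is the poset whose Hasse diagram is the union of the maximal chains of $\mathrm{NC}_{n+1}$ corresponding to elements of $\mathrm{PF}_{n,n}$: its elements are the noncrossing partitions lying on at least one of these chains, and its order is the reflexive-transitive closure of the covering relations occurring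 in these chains (it need not be an induced subposet of $\mathrm{NC}_{n+1}$). -}

module Defs where

open import Data.Fin.Base as Fin using (Fin; toℕ; inject₁)
open import Data.Fin.Subset using (Subset; _∈_; _∉_; _⊆_; _∪_)
open import Data.Fin.Subset.Properties using (⊆-refl; ⊆-trans; ⊆-antisym)
open import Data.Integer.Base using (+_; -_; _-_)
import Data.List.Base as List
open import Data.List.Sort using (sort)
open import Data.Nat.Base as ℕ using (ℕ; suc)
open import Data.Nat.Properties using (≤-decTotalOrder)
open import Data.Product.Base using (Σ; ∃; ∃₂; _×_; _,_; proj₁; proj₂)
open import Data.Rational.Base as ℚ using (ℚ; 0ℚ; 1ℚ; _/_)
open import Data.Rational.Properties using (+-0-commutativeMonoid)
open import Data.Sum.Base using (_⊎_)
open import Data.Vec.Base using (Vec; lookup; tabulate; toList)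
open import Data.Vec.Functional using (Vector)
open import Data.Vec.Properties using (tabulate∘lookup; tabulate-cong)
open import Level using (0ℓ)
open import Relation.Binary.Bundles using (Poset)
open import Relation.Binary.Construct.Closure.ReflexiveTransitive using (Star; ε; _◅_; _◅◅_)
open import Relation.Binary.Core using (Rel)
open import Relation.Binary.Definitions using (Minimum; Maximum)
open import Relation.Binary.Morphism.Structures using (IsOrderIsomorphism)
open import Relation.Binary.PropositionalEquality
  using (_≡_; _≢_; refl; sym; trans; isEquivalence; module ≡-Reasoning)
open import Relation.Nullary.Negation using (¬_)
open import Relation.Unary using (Pred)

open import Algebra.Properties.CommutativeMonoid.Sum +-0-commutativeMonoid using (sum)

-- Elements of [m] are indexed by Fin m: the index x stands for the positive
-- integer ⟦ x ⟧, so the order of Fin m is the usual order of [m].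

⟦_⟧ : ∀ {m} → Fin m → ℕ
⟦ x ⟧ = suc (toℕ x)

------------------------------------------------------------------------
-- Set partitions

-- A partition is stored as the map sending each element to its block.  Since
-- subsets are Boolean vectors and the laws are irrelevant, two partitions with
-- the same blocks are propositionally equal.

record Partition (m : ℕ) : Set where
  constructor mkPartition
  field
    blocks    : Vec (Subset m) m
    .covering : ∀ x → x ∈ lookup blocks x
    .disjoint : ∀ x y z → z ∈ lookup blocks x → z ∈ lookup blocks y →
                lookup blocks x ≡ lookup blocks y

  block : Fin m → Subset m
  block = lookup blocks

  IsBlock : Pred (Subset m) 0ℓ
  IsBlock B = ∃ λ x → B ≡ block x

open Partition public using (block; IsBlock)

_⊑_ : ∀ {m} → Rel (Partition m) 0ℓ
σ ⊑ τ = ∀ x → block σ x ⊆ block τ x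

⊑-antisym : ∀ {m} {σ τ : Partition m} → σ ⊑ τ → τ ⊑ σ → σ ≡ τ
⊑-antisym {m} {σ} {τ} p q = helper eq
  where
  open ≡-Reasoning
  eq : Partition.blocks σ ≡ Partition.blocks τ
  eq = begin
    Partition.blocks σ                     ≡⟨ tabulate∘lookup _ ⟨
    tabulate (lookup (Partition.blocks σ)) ≡⟨ tabulate-cong (λ x → ⊆-antisym (p x) (q x)) ⟩
    tabulate (lookup (Partition.blocks τ)) ≡⟨ tabulate∘lookup _ ⟩
    Partition.blocks τ                     ∎
  helper : ∀ {σ τ : Partition m} → Partition.blocks σ ≡ Partition.blocks τ → σ ≡ τ
  helper refl = refl

------------------------------------------------------------------------
-- Noncrossing partitions

-- With t = toℕ x, the element x is placed at the point
-- ((1 - t²) / (1 + t²) , - 2t / (1 + t²)) of the unit circle, whose angle is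
-- - 2 arctan t; these points occur in clockwise order.  All points being
-- rational, convex hulls of disjoint sets of them meet over ℝ if and only if
-- they meet over ℚ.

Point : Set
Point = ℚ × ℚ

point : ∀ {m} → Fin m → Point
point x = let t = toℕ x in
  ((+ 1 - + (t ℕ.* t)) / suc (t ℕ.* t)) , ((- + (2 ℕ.* t)) / suc (t ℕ.* t))

record ConvexHull {m} (B : Subset m) (p : Point) : Set where
  field
    weight      : Vector ℚ m
    nonnegative : ∀ x → 0ℚ ℚ.≤ weight x
    supported   : ∀ x → x ∉ B → weight x ≡ 0ℚ
    total       : sum weight ≡ 1ℚ
    abscissa    : sum (λ x → weight x ℚ.* proj₁ (point x)) ≡ proj₁ p
    ordinate    : sum (λ x → weight x ℚ.* proj₂ (point x)) ≡ proj₂ p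

Noncrossing : ∀ {m} → Pred (Partition m) 0ℓ
Noncrossing σ = ∀ {B C} → IsBlock σ B → IsBlock σ C → B ≢ C →
                ∀ p → ¬ (ConvexHull B p × ConvexHull C p)

record NC (m : ℕ) : Set where
  constructor mkNC
  field
    partition    : Partition m
    .noncrossing : Noncrossing partition

open NC public using (partition)

_≤ᴺ_ : ∀ {m} → Rel (NC m) 0ℓ
σ ≤ᴺ τ = partition σ ⊑ partition τ

≤ᴺ-antisym : ∀ {m} {σ τ : NC m} → σ ≤ᴺ τ → τ ≤ᴺ σ → σ ≡ τ
≤ᴺ-antisym {m} {σ} {τ} p q = helper (⊑-antisym {σ = partition σ} {partition τ} p q)
  where
  helper : ∀ {σ τ : NC m} → partition σ ≡ partition τ → σ ≡ τ
  helper refl = refl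

NC-poset : ℕ → Poset 0ℓ 0ℓ 0ℓ
NC-poset m = record
  { Carrier        = NC m
  ; _≈_            = _≡_
  ; _≤_            = _≤ᴺ_
  ; isPartialOrder = record
    { isPreorder = record
      { isEquivalence = isEquivalence
      ; reflexive     = λ { refl x → ⊆-refl }
      ; trans         = λ p q x → ⊆-trans (p x) (q x)
      }
    ; antisym = ≤ᴺ-antisym
    }
  }

_⋖_ : ∀ {m} → Rel (NC m) 0ℓ
σ ⋖ τ = σ ≤ᴺ τ × σ ≢ τ × (∀ ρ → σ ≤ᴺ ρ → ρ ≤ᴺ τ → ρ ≡ σ ⊎ ρ ≡ τ)

-- For a covering relation σ ⋖ τ, exactly one block of τ is a union of two
-- different blocks of σ, so that at most one k satisfies IsLabel σ τ k.

record IsLabel {m} (σ τ : NC m) (k : ℕ) : Set where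
  field
    {B₁ B₂}     : Subset m
    B₁-block    : IsBlock (partition σ) B₁
    B₂-block    : IsBlock (partition σ) B₂
    B₁≢B₂       : B₁ ≢ B₂
    merged      : IsBlock (partition τ) (B₁ ∪ B₂)
    min∈B₁      : ∃ λ x → x ∈ B₁ × (∀ y → y ∈ B₁ ∪ B₂ → x Fin.≤ y)
    largest     : Fin m
    largest∈B₁  : largest ∈ B₁
    largest<B₂  : ∀ y → y ∈ B₂ → largest Fin.< y
    isLargest   : ∀ x → x ∈ B₁ → (∀ y → y ∈ B₂ → x Fin.< y) → x Fin.≤ largest
    label       : k ≡ ⟦ largest ⟧

-- Every maximal chain of NC (suc n) has n covering relations.

record MaximalChain (n : ℕ) : Set where
  field
    element : Fin (suc n) → NC (suc n)
    bottom  : Minimum _≤ᴺ_ (element Fin.zero)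
    top     : Maximum _≤ᴺ_ (element (Fin.fromℕ n))
    covers  : ∀ i → element (inject₁ i) ⋖ element (Fin.suc i)

open MaximalChain public using (element)

HasLabels : ∀ {n} → MaximalChain n → Vec ℕ n → Set
HasLabels c a = ∀ i → IsLabel (element c (inject₁ i)) (element c (Fin.suc i)) (lookup a i)

------------------------------------------------------------------------
-- Parking functions

-- The bound reads b_i ≤ i for the 1-based position i.

IsParking : ∀ {n} → Pred (Vec ℕ n) 0ℓ
IsParking a =
  (∀ i → 1 ℕ.≤ lookup a i) ×
  (let b = sort ≤-decTotalOrder (toList a) in ∀ i → List.lookup b i ℕ.≤ ⟦ i ⟧)

PFₙₙ : ∀ n → Pred (Vec ℕ n) 0ℓ
PFₙₙ n a = IsParking a × (∀ i → lookup a i ≢ n)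

------------------------------------------------------------------------
-- Poset(PF_{n,n})

record PFChain (n : ℕ) : Set where
  field
    chain     : MaximalChain n
    labels    : Vec ℕ n
    hasLabels : HasLabels chain labels
    parking   : PFₙₙ n labels

open PFChain public using (chain)

OnPFChain : ∀ n → Pred (NC (suc n)) 0ℓ
OnPFChain n σ = ∃₂ λ (c : PFChain n) i → σ ≡ element (chain c) i

PFCover : ∀ n → Rel (NC (suc n)) 0ℓ
PFCover n σ τ = ∃₂ λ (c : PFChain n) i →
  σ ≡ element (chain c) (inject₁ i) × τ ≡ element (chain c) (Fin.suc i)

PFCover*⇒≤ᴺ : ∀ {n} {σ τ : NC (suc n)} → Star (PFCover n) σ τ → σ ≤ᴺ τ
PFCover*⇒≤ᴺ ε x = ⊆-refl
PFCover*⇒≤ᴺ ((c , i , refl , refl) ◅ ps) x =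
  ⊆-trans (proj₁ (MaximalChain.covers (chain c) i) x) (PFCover*⇒≤ᴺ ps x)

-- An element carries a witness that it lies on some chain; the equality of the
-- poset ignores this witness.

PosetPFₙₙ : ℕ → Poset 0ℓ 0ℓ 0ℓ
PosetPFₙₙ n = record
  { Carrier        = Σ (NC (suc n)) (OnPFChain n)
  ; _≈_            = λ x y → proj₁ x ≡ proj₁ y
  ; _≤_            = λ x y → Star (PFCover n) (proj₁ x) (proj₁ y)
  ; isPartialOrder = record
    { isPreorder = record
      { isEquivalence = record { refl = refl ; sym = sym ; trans = trans }
      ; reflexive     = λ { refl → ε }
      ; trans         = _◅◅_
      }
    ; antisym = λ p q → ≤ᴺ-antisym (PFCover*⇒≤ᴺ p) (PFCover*⇒≤ᴺ q)
    }
  }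

------------------------------------------------------------------------
-- Automorphisms

IsAutomorphism : ∀ {c ℓ₁ ℓ₂} (P : Poset c ℓ₁ ℓ₂) → let open Poset P in
                 (Carrier → Carrier) → Set _
IsAutomorphism P = IsOrderIsomorphism _≈_ _≈_ _≤_ _≤_
  where open Poset P

{-# OPTIONS --safe #-}

-- Let N and L stand for n and n + 1.  A covering relation has label n exactly
-- when it merges the singleton {L} with the block of N.  Consequently σ lies below
-- τ in Poset(PF_{n,n}) if and only if σ refines τ and, in case τ joins N and L but
-- σ does not, the block of N in τ has an element below the block of N in σ.
--
-- Write s_d and t_d (d < N) for the partitions with the only nontrivial block
-- {d, L}, respectively {d, N, L}.  The pairs (A, U) such that exactly A and the
-- bottom are strictly below U are the pairs (s_d, t_d), so an automorphism permutes
-- the s_d, and it preserves the property N ~ L, which says that some t_d is below.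
-- One has d ≤ e if and only if every partition with N ≁ L above s_e is below one
-- above s_d; a permutation preserving this order fixes every s_d.  Then it fixes
-- the partition {1, …, e, L} | {e + 1, …, N}, the largest one with N ≁ L above s_e
-- but above no s_d with d > e.  The atom {i, j} with i < j ≤ N is below this
-- partition unless i ≤ e < j, so all atoms are fixed.  Finally a partition is
-- determined by the atoms below it and by whether N ~ L.

module Submission where

open import Defs
open import Data.Nat.Base using (ℕ; _≤_)
open import Data.Product.Base using (_×_)
open import Function.Base using (id)
open import Relation.Binary.Bundles using (module Poset)

open import Data.Bool.Base using (true)
import Data.Bool.Properties as Boolₚ
open import Data.Empty using (⊥; ⊥-elim; ⊥-elim-irr)
open import Data.Fin.Base as Fin using (Fin; zero; suc; toℕ; fromℕ; inject₁)
import Data.Fin.Properties as Finₚ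
open import Data.Fin.Subset using (Subset; _∈_; _∪_)
open import Data.Fin.Subset.Properties using (_∈?_; ⊆-antisym; x∈p∪q⁻; x∈p∪q⁺)
open import Data.Integer.Base as ℤ using (ℤ) renaming (+_ to ⁺_)
import Data.Integer.Properties as ℤₚ
open import Data.Integer.Tactic.RingSolver using (solve-∀)
import Data.List.Base as List
open import Data.List.Base using (List; []; _∷_; length; filter)
import Data.List.Properties as Listₚ
open import Data.List.Relation.Binary.Permutation.Propositional.Properties using (↭-length; filter-↭)
open import Data.List.Relation.Unary.All as All using (All; []; _∷_)
open import Data.List.Relation.Unary.AllPairs using (AllPairs; []; _∷_)
open import Data.List.Relation.Unary.Linked.Properties using (Linked⇒AllPairs)
import Data.Nat.Base as ℕ
open import Data.Nat.Base using (zero; suc; z≤n; s≤s)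
import Data.Nat.Properties as ℕₚ
open import Data.List.Sort ℕₚ.≤-decTotalOrder using (sort; sort-↭; sort-↗)
open import Data.Product.Base using (Σ; ∃; ∃₂; _,_; proj₁; proj₂)
open import Data.Rational.Base as ℚ using (ℚ; 0ℚ; 1ℚ; _/_; _+_; _*_; _-_; -_)
import Data.Rational.Properties as ℚₚ
open import Data.Rational.Solver using (module +-*-Solver)
import Data.Rational.Unnormalised.Base as ℚᵘ
import Data.Rational.Unnormalised.Properties as ℚᵘₚ
open import Data.Sum.Base using (_⊎_; inj₁; inj₂; [_,_]′)
open import Data.Unit.Base using (⊤; tt)
open import Data.Vec.Base using (Vec; []; _∷_; lookup; tabulate; toList)
open import Data.Vec.Functional using (Vector)
import Data.Vec.Properties as Vecₚ
open import Function.Base using (_∘_; flip)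
open import Level using (0ℓ)
open import Relation.Binary.Construct.Closure.ReflexiveTransitive using (Star; ε; _◅_; _◅◅_)
open import Relation.Binary.Core using (Rel)
open import Relation.Binary.Definitions using (Tri; tri<; tri≈; tri>) renaming (Decidable to Decidable₂)
open import Relation.Binary.Morphism.Structures using (IsOrderIsomorphism)
open import Relation.Binary.PropositionalEquality
open import Relation.Binary.Structures using (IsEquivalence)
open import Relation.Nullary using (¬_; Dec; yes; no; does; contradiction; recompute)
open import Relation.Nullary.Decidable using (_×-dec_; _⊎-dec_; _→-dec_; ¬?; decidable-stable)
open import Relation.Unary using (Decidable; Pred)

open import Algebra.Properties.CommutativeMonoid.Sum ℚₚ.+-0-commutativeMonoid
  using (sum; sum-cong-≗; ∑-distrib-+)

-- The order is generated by chains and has fewer relations than refinement, so everything rests on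
-- deciding when a chain without the label n exists. Such a chain is built merge by merge, and its
-- label sequence is shown to be parking by counting the block minima that the merges destroy. The
-- one danger is a singleton {L} that has to end up with N: once the block of N contains the least
-- element of its final block, merging {L} with any other part of that final block would cross it.
-- So {L} is attached early, to the block of that least element, and from then on refinement alone
-- governs the order.
--
-- Two consequences drive the rigidity: {N, L} is a block of no element of the poset, and the
-- partition with the only nontrivial block {d, N} refines t_d without lying below it. This turns
-- the set below t_d into a chain of three elements. No principal ideal of that kind arises where N
-- and L are apart, because every pair inside a block then gives an atom below.

private variable
  m : ℕ

-- Noncrossing partitions through convex hulls

/1-homo-+ : ∀ i j → (i ℤ.+ j) / 1 ≡ i / 1 + j / 1
/1-homo-+ i j = ℚₚ.toℚᵘ-injective (begin
  ℚ.toℚᵘ ((i ℤ.+ j) / 1)                    ≈⟨ ℚₚ.toℚᵘ-fromℚᵘ (ℚᵘ.mkℚᵘ (i ℤ.+ j) 0) ⟩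
  ℚᵘ.mkℚᵘ (i ℤ.+ j) 0                       ≈⟨ ℚᵘ.*≡* (lemma i j) ⟩
  ℚᵘ.mkℚᵘ i 0 ℚᵘ.+ ℚᵘ.mkℚᵘ j 0
    ≈⟨ ℚᵘₚ.+-cong (ℚₚ.toℚᵘ-fromℚᵘ (ℚᵘ.mkℚᵘ i 0)) (ℚₚ.toℚᵘ-fromℚᵘ (ℚᵘ.mkℚᵘ j 0)) ⟨
  ℚ.toℚᵘ (i / 1) ℚᵘ.+ ℚ.toℚᵘ (j / 1)        ≈⟨ ℚₚ.toℚᵘ-homo-+ (i / 1) (j / 1) ⟨
  ℚ.toℚᵘ (i / 1 + j / 1)                    ∎)
  where
  open ℚᵘₚ.≃-Reasoning
  lemma : ∀ i j → (i ℤ.+ j) ℤ.* (⁺ 1 ℤ.* ⁺ 1) ≡ (i ℤ.* ⁺ 1 ℤ.+ j ℤ.* ⁺ 1) ℤ.* ⁺ 1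
  lemma = solve-∀

/-*-/1 : ∀ i k j → (i / suc k) * (j / 1) ≡ (i ℤ.* j) / suc k
/-*-/1 i k j = ℚₚ.toℚᵘ-injective (begin
  ℚ.toℚᵘ ((i / suc k) * (j / 1))            ≈⟨ ℚₚ.toℚᵘ-homo-* (i / suc k) (j / 1) ⟩
  ℚ.toℚᵘ (i / suc k) ℚᵘ.* ℚ.toℚᵘ (j / 1)
    ≈⟨ ℚᵘₚ.*-cong (ℚₚ.toℚᵘ-fromℚᵘ (ℚᵘ.mkℚᵘ i k)) (ℚₚ.toℚᵘ-fromℚᵘ (ℚᵘ.mkℚᵘ j 0)) ⟩
  ℚᵘ.mkℚᵘ i k ℚᵘ.* ℚᵘ.mkℚᵘ j 0              ≈⟨ ℚᵘ.*≡* (lemma i j (⁺ suc k)) ⟩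
  ℚᵘ.mkℚᵘ (i ℤ.* j) k                       ≈⟨ ℚₚ.toℚᵘ-fromℚᵘ (ℚᵘ.mkℚᵘ (i ℤ.* j) k) ⟨
  ℚ.toℚᵘ ((i ℤ.* j) / suc k)                ∎)
  where
  open ℚᵘₚ.≃-Reasoning
  lemma : ∀ i j (k : ℤ) → (i ℤ.* j) ℤ.* k ≡ (i ℤ.* j) ℤ.* (k ℤ.* ⁺ 1)
  lemma = solve-∀

/-cancel : ∀ i k → (i ℤ.* ⁺ suc k) / suc k ≡ i / 1
/-cancel i k = ℚₚ.fromℚᵘ-cong {ℚᵘ.mkℚᵘ (i ℤ.* ⁺ suc k) k} {ℚᵘ.mkℚᵘ i 0}
  (ℚᵘ.*≡* (ℤₚ.*-identityʳ _))

/1-homo-* : ∀ i j → (i ℤ.* j) / 1 ≡ (i / 1) * (j / 1)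
/1-homo-* i j = sym (/-*-/1 i 0 j)

/1-homo-neg : ∀ i → (ℤ.- i) / 1 ≡ - (i / 1)
/1-homo-neg i = begin
  (ℤ.- i) / 1                             ≡⟨ ring ((ℤ.- i) / 1) (i / 1) ⟩
  ((ℤ.- i) / 1 + i / 1) + - (i / 1)       ≡⟨ cong (_+ - (i / 1)) (sym (/1-homo-+ (ℤ.- i) i)) ⟩
  ((ℤ.- i) ℤ.+ i) / 1 + - (i / 1)         ≡⟨ cong (λ z → z / 1 + - (i / 1)) (ℤₚ.+-inverseˡ i) ⟩
  0ℚ + - (i / 1)                          ≡⟨ ℚₚ.+-identityˡ _ ⟩
  - (i / 1)                               ∎
  where
  open ≡-Reasoning
  open +-*-Solver
  ring : ∀ x y → x ≡ (x + y) + - y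
  ring = solve 2 (λ x y → x := (x :+ y) :+ :- y) refl

ι : ℕ → ℚ
ι t = ⁺ t / 1

ι-homo-+ : ∀ s t → ι (s ℕ.+ t) ≡ ι s + ι t
ι-homo-+ s t = /1-homo-+ (⁺ s) (⁺ t)

ι-homo-* : ∀ s t → ι (s ℕ.* t) ≡ ι s * ι t
ι-homo-* s t = trans (cong (_/ 1) (ℤₚ.pos-* s t)) (/1-homo-* (⁺ s) (⁺ t))

ι-nonNeg : ∀ t → 0ℚ ℚ.≤ ι t
ι-nonNeg t = ℚₚ.nonNegative⁻¹ (ι t) {{ℚₚ.normalize-nonNeg t 1}}

0<ι-suc : ∀ t → 0ℚ ℚ.< ι (suc t)
0<ι-suc t = ℚₚ.positive⁻¹ (ι (suc t)) {{ℚₚ.normalize-pos (suc t) 1}}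

private
  difference : ∀ s t → ι s + ι t - ι s ≡ ι t
  difference s t = solve 2 (λ a b → a :+ b :- a := b) refl (ι s) (ι t)
    where open +-*-Solver

ι-gap-nonNeg : ∀ {s t} → s ℕ.≤ t → 0ℚ ℚ.≤ ι t - ι s
ι-gap-nonNeg {s} {t} s≤t = subst (0ℚ ℚ.≤_)
  (sym (trans (cong (_- ι s) (trans (cong ι (sym (ℕₚ.m+[n∸m]≡n s≤t))) (ι-homo-+ s (t ℕ.∸ s))))
    (difference s (t ℕ.∸ s))))
  (ι-nonNeg (t ℕ.∸ s))

ι-gap-pos : ∀ {s t} → s ℕ.< t → 0ℚ ℚ.< ι t - ι s
ι-gap-pos {s} {t} s<t = subst (0ℚ ℚ.<_)
  (sym (trans (cong (_- ι s) (trans (cong ι eq) (ι-homo-+ s (suc (t ℕ.∸ suc s))))) (difference s (suc (t ℕ.∸ suc s)))))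
  (0<ι-suc (t ℕ.∸ suc s))
  where
  eq : t ≡ s ℕ.+ suc (t ℕ.∸ suc s)
  eq = sym (trans (ℕₚ.+-suc s _) (ℕₚ.m+[n∸m]≡n s<t))

-- Rational points of the circle, separating chords and crossing chords

module _ {m} (x : Fin m) where
  private t = toℕ x

  abscissa ordinate parameter : ℚ
  abscissa  = proj₁ (point x)
  ordinate  = proj₂ (point x)
  parameter = ι t

  private
    T² = parameter * parameter

    ι[1+t²] : ι (suc (t ℕ.* t)) ≡ 1ℚ + T²
    ι[1+t²] = trans (ι-homo-+ 1 (t ℕ.* t)) (cong (1ℚ +_) (ι-homo-* t t))

    clear : ∀ i → (i / suc (t ℕ.* t)) * (1ℚ + T²) ≡ i / 1
    clear i = begin
      (i / suc (t ℕ.* t)) * (1ℚ + T²)           ≡⟨ cong ((i / suc (t ℕ.* t)) *_) ι[1+t²] ⟨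
      (i / suc (t ℕ.* t)) * ι (suc (t ℕ.* t))   ≡⟨ /-*-/1 i (t ℕ.* t) _ ⟩
      (i ℤ.* ⁺ suc (t ℕ.* t)) / suc (t ℕ.* t)   ≡⟨ /-cancel i (t ℕ.* t) ⟩
      i / 1                                     ∎
      where open ≡-Reasoning

  abscissa-eq : abscissa * (1ℚ + T²) ≡ 1ℚ - T²
  abscissa-eq = begin
    abscissa * (1ℚ + T²)                   ≡⟨ clear (⁺ 1 ℤ.- ⁺ (t ℕ.* t)) ⟩
    (⁺ 1 ℤ.- ⁺ (t ℕ.* t)) / 1              ≡⟨ /1-homo-+ (⁺ 1) (ℤ.- ⁺ (t ℕ.* t)) ⟩
    1ℚ + (ℤ.- ⁺ (t ℕ.* t)) / 1             ≡⟨ cong (1ℚ +_) (/1-homo-neg (⁺ (t ℕ.* t))) ⟩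
    1ℚ - ι (t ℕ.* t)                       ≡⟨ cong (λ z → 1ℚ - z) (ι-homo-* t t) ⟩
    1ℚ - T²                                ∎
    where open ≡-Reasoning

  ordinate-eq : ordinate * (1ℚ + T²) ≡ - (parameter + parameter)
  ordinate-eq = begin
    ordinate * (1ℚ + T²)           ≡⟨ clear (ℤ.- ⁺ (2 ℕ.* t)) ⟩
    (ℤ.- ⁺ (2 ℕ.* t)) / 1          ≡⟨ /1-homo-neg (⁺ (2 ℕ.* t)) ⟩
    - ι (2 ℕ.* t)                  ≡⟨ cong (λ z → - ι (t ℕ.+ z)) (ℕₚ.+-identityʳ t) ⟩
    - ι (t ℕ.+ t)                  ≡⟨ cong -_ (ι-homo-+ t t) ⟩
    - (parameter + parameter)      ∎
    where open ≡-Reasoning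

  0<1+T² : 0ℚ ℚ.< 1ℚ + T²
  0<1+T² = subst (0ℚ ℚ.<_) ι[1+t²] (0<ι-suc (t ℕ.* t))

*-nonNeg : ∀ {p q} → 0ℚ ℚ.≤ p → 0ℚ ℚ.≤ q → 0ℚ ℚ.≤ p * q
*-nonNeg {p} {q} 0≤p 0≤q = ℚₚ.nonNegative⁻¹ (p * q)
  {{ℚₚ.nonNeg*nonNeg⇒nonNeg p {{ℚ.nonNegative 0≤p}} q {{ℚ.nonNegative 0≤q}}}}

*-pos : ∀ {p q} → 0ℚ ℚ.< p → 0ℚ ℚ.< q → 0ℚ ℚ.< p * q
*-pos {p} {q} 0<p 0<q = ℚₚ.positive⁻¹ (p * q)
  {{ℚₚ.pos*pos⇒pos p {{ℚ.positive 0<p}} q {{ℚ.positive 0<q}}}}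

*-cancel-nonNeg : ∀ {p q} → 0ℚ ℚ.< q → 0ℚ ℚ.≤ p * q → 0ℚ ℚ.≤ p
*-cancel-nonNeg {p} {q} 0<q 0≤pq = ℚₚ.*-cancelʳ-≤-pos q {{ℚ.positive 0<q}}
  (subst (ℚ._≤ p * q) (sym (ℚₚ.*-zeroˡ q)) 0≤pq)

*-cancel-pos : ∀ {p q} → 0ℚ ℚ.< q → 0ℚ ℚ.< p * q → 0ℚ ℚ.< p
*-cancel-pos {p} {q} 0<q 0<pq = ℚₚ.*-cancelʳ-<-nonNeg q {{ℚₚ.pos⇒nonNeg q {{ℚ.positive 0<q}}}}
  (subst (ℚ._< p * q) (sym (ℚₚ.*-zeroˡ q)) 0<pq)

sum-*ˡ : ∀ c (f : Vector ℚ m) → sum (λ x → c * f x) ≡ c * sum f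
sum-*ˡ {zero}  c f = sym (ℚₚ.*-zeroʳ c)
sum-*ˡ {suc m} c f = trans (cong (c * f zero +_) (sum-*ˡ c (f ∘ suc))) (sym (ℚₚ.*-distribˡ-+ c _ _))

sum-zero : (f : Vector ℚ m) → (∀ x → f x ≡ 0ℚ) → sum f ≡ 0ℚ
sum-zero {zero}  f f≡0 = refl
sum-zero {suc m} f f≡0 = cong₂ _+_ (f≡0 zero) (sum-zero (f ∘ suc) (f≡0 ∘ suc))

sum-nonNeg : (f : Vector ℚ m) → (∀ x → 0ℚ ℚ.≤ f x) → 0ℚ ℚ.≤ sum f
sum-nonNeg {zero}  f 0≤f = ℚₚ.≤-refl
sum-nonNeg {suc m} f 0≤f = ℚₚ.+-mono-≤ (0≤f zero) (sum-nonNeg (f ∘ suc) (0≤f ∘ suc))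

sum≤0⇒≤0 : (f : Vector ℚ m) → (∀ x → 0ℚ ℚ.≤ f x) → sum f ℚ.≤ 0ℚ → ∀ x → f x ℚ.≤ 0ℚ
sum≤0⇒≤0 {suc m} f 0≤f Σ≤0 zero = ℚₚ.≤-trans
  (subst (ℚ._≤ sum f) (ℚₚ.+-identityʳ _) (ℚₚ.+-monoʳ-≤ (f zero) (sum-nonNeg (f ∘ suc) (0≤f ∘ suc)))) Σ≤0
sum≤0⇒≤0 {suc m} f 0≤f Σ≤0 (suc x) = sum≤0⇒≤0 (f ∘ suc) (0≤f ∘ suc) (ℚₚ.≤-trans
  (subst (ℚ._≤ sum f) (ℚₚ.+-identityˡ _) (ℚₚ.+-monoˡ-≤ (sum (f ∘ suc)) (0≤f zero))) Σ≤0) x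

sum-affine : ∀ c₀ c₁ c₂ (w f g : Vector ℚ m) →
  sum (λ x → w x * (c₀ + c₁ * f x + c₂ * g x)) ≡
  c₀ * sum w + c₁ * sum (λ x → w x * f x) + c₂ * sum (λ x → w x * g x)
sum-affine c₀ c₁ c₂ w f g = begin
  sum (λ x → w x * (c₀ + c₁ * f x + c₂ * g x))
    ≡⟨ sum-cong-≗ (λ x → expand (w x) (f x) (g x)) ⟩
  sum (λ x → (c₀ * w x + c₁ * (w x * f x)) + c₂ * (w x * g x))
    ≡⟨ ∑-distrib-+ (λ x → c₀ * w x + c₁ * (w x * f x)) _ ⟩
  sum (λ x → c₀ * w x + c₁ * (w x * f x)) + sum (λ x → c₂ * (w x * g x))
    ≡⟨ cong (_+ sum (λ x → c₂ * (w x * g x))) (∑-distrib-+ (λ x → c₀ * w x) _) ⟩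
  sum (λ x → c₀ * w x) + sum (λ x → c₁ * (w x * f x)) + sum (λ x → c₂ * (w x * g x))
    ≡⟨ cong₂ _+_ (cong₂ _+_ (sum-*ˡ c₀ w) (sum-*ˡ c₁ (λ x → w x * f x))) (sum-*ˡ c₂ (λ x → w x * g x)) ⟩
  c₀ * sum w + c₁ * sum (λ x → w x * f x) + c₂ * sum (λ x → w x * g x) ∎
  where
  open ≡-Reasoning
  expand : ∀ a b c → a * (c₀ + c₁ * b + c₂ * c) ≡ (c₀ * a + c₁ * (a * b)) + c₂ * (a * c)
  expand a b c = solve 6 (λ a b c d e f →
    a :* (d :+ e :* b :+ f :* c) := (d :* a :+ e :* (a :* b)) :+ f :* (a :* c)) refl a b c c₀ c₁ c₂
    where open +-*-Solver

-- The chord through the points of u and v is the zero set of an affine form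
-- whose value at the point of parameter T is 2 (T - U) (T - V) / (1 + T²).
module Chord (U V : ℚ) where

  c₀ c₁ c₂ : ℚ
  c₀ = 1ℚ + U * V
  c₁ = U * V - 1ℚ
  c₂ = U + V

  form : Fin m → ℚ
  form x = c₀ + c₁ * abscissa x + c₂ * ordinate x

  form-eq : (x : Fin m) → let T = parameter x in
            form x * (1ℚ + T * T) ≡ (T - U) * (T - V) + (T - U) * (T - V)
  form-eq x = begin
    form x * (1ℚ + T * T)
      ≡⟨ solve 6 (λ a b c d e f → (a :+ b :* c :+ d :* e) :* f := a :* f :+ b :* (c :* f) :+ d :* (e :* f)) refl
           c₀ c₁ (abscissa x) c₂ (ordinate x) (1ℚ + T * T) ⟩
    c₀ * (1ℚ + T * T) + c₁ * (abscissa x * (1ℚ + T * T)) + c₂ * (ordinate x * (1ℚ + T * T))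
      ≡⟨ cong₂ (λ a b → c₀ * (1ℚ + T * T) + c₁ * a + c₂ * b) (abscissa-eq x) (ordinate-eq x) ⟩
    c₀ * (1ℚ + T * T) + c₁ * (1ℚ - T * T) + c₂ * - (T + T)
      ≡⟨ solve 3 (λ T U V →
           (con 1ℚ :+ U :* V) :* (con 1ℚ :+ T :* T) :+ (U :* V :- con 1ℚ) :* (con 1ℚ :- T :* T) :+ (U :+ V) :* :- (T :+ T) :=
           (T :- U) :* (T :- V) :+ (T :- U) :* (T :- V)) refl T U V ⟩
    (T - U) * (T - V) + (T - U) * (T - V) ∎
    where
    open ≡-Reasoning
    open +-*-Solver
    T = parameter x

  -- The weights sum to one, so an affine form takes at `p` the weighted mean of its values at the
  -- points of the circle.
  hull-value : ∀ {B : Subset m} {p} (h : ConvexHull B p) →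
               sum (λ x → ConvexHull.weight h x * form x) ≡ c₀ + c₁ * proj₁ p + c₂ * proj₂ p
  hull-value h = trans (sum-affine c₀ c₁ c₂ weight abscissa ordinate)
    (cong₂ _+_ (cong₂ _+_ (trans (cong (c₀ *_) total) (ℚₚ.*-identityʳ c₀)) (cong (c₁ *_) abscissa-total))
               (cong (c₂ *_) ordinate-total))
    where open ConvexHull h renaming (abscissa to abscissa-total; ordinate to ordinate-total)

-- The chord form through `u` and `v` is positive on `B` and at most zero on `C`; if `u` equals `v`,
-- the chord degenerates to a tangent. At a common point the value is at most zero by `C`, so the
-- nonnegative terms coming from `B` all vanish and every weight on `B` is zero, although the
-- weights sum to one.
hulls-disjoint : ∀ {B C : Subset m} (u v : Fin m) →
  (∀ {c} → c ∈ C → u Fin.≤ c × c Fin.≤ v) →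
  (∀ {b} → b ∈ B → b Fin.< u ⊎ v Fin.< b) → u Fin.≤ v →
  ∀ p → ¬ (ConvexHull B p × ConvexHull C p)
hulls-disjoint {B = B} {C} u v C-inside B-outside u≤v p (hB , hC) = ℚₚ.1≢0 (trans (sym B.total) (sum-zero B.weight wB≡0))
  where
  module B = ConvexHull hB
  module C = ConvexHull hC
  open Chord (parameter u) (parameter v)
  open +-*-Solver

  form-pos : ∀ {b} → b ∈ B → 0ℚ ℚ.< form b
  form-pos {b} b∈B = *-cancel-pos (0<1+T² b) (subst (0ℚ ℚ.<_) (sym (form-eq b)) (ℚₚ.+-mono-< square square))
    where
    T = parameter b
    square : 0ℚ ℚ.< (T - parameter u) * (T - parameter v)
    square with B-outside b∈B
    ... | inj₁ b<u = subst (0ℚ ℚ.<_)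
      (solve 3 (λ T U V → (U :- T) :* (V :- T) := (T :- U) :* (T :- V)) refl T (parameter u) (parameter v))
      (*-pos (ι-gap-pos b<u) (ι-gap-pos (ℕₚ.<-≤-trans b<u u≤v)))
    ... | inj₂ v<b = *-pos (ι-gap-pos (ℕₚ.≤-<-trans u≤v v<b)) (ι-gap-pos v<b)

  form-nonPos : ∀ {c} → c ∈ C → 0ℚ ℚ.≤ - form c
  form-nonPos {c} c∈C = *-cancel-nonNeg (0<1+T² c) (subst (0ℚ ℚ.≤_)
    (sym (trans (sym (ℚₚ.neg-distribˡ-* (form c) _)) (cong -_ (form-eq c))))
    (subst (0ℚ ℚ.≤_)
      (solve 3 (λ T U V →
        (T :- U) :* (V :- T) :+ (T :- U) :* (V :- T) := :- ((T :- U) :* (T :- V) :+ (T :- U) :* (T :- V)))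
        refl T (parameter u) (parameter v))
      (ℚₚ.+-mono-≤ square square)))
    where
    T = parameter c
    square : 0ℚ ℚ.≤ (T - parameter u) * (parameter v - T)
    square = *-nonNeg (ι-gap-nonNeg (proj₁ (C-inside c∈C))) (ι-gap-nonNeg (proj₂ (C-inside c∈C)))

  value : ℚ
  value = c₀ + c₁ * proj₁ p + c₂ * proj₂ p

  value≤0 : value ℚ.≤ 0ℚ
  value≤0 = subst (ℚ._≤ 0ℚ) (solve 1 (λ a → :- :- a := a) refl value) (ℚₚ.neg-antimono-≤ 0≤-v)
    where
    term : ∀ x → 0ℚ ℚ.≤ C.weight x * - form x
    term x with x ∈? C
    ... | yes x∈C = *-nonNeg (C.nonnegative x) (form-nonPos x∈C)
    ... | no  x∉C = ℚₚ.≤-reflexive (sym (trans (cong (_* - form x) (C.supported x x∉C)) (ℚₚ.*-zeroˡ (- form x))))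
    0≤-v : 0ℚ ℚ.≤ - value
    0≤-v = subst (0ℚ ℚ.≤_) (begin
      sum (λ x → C.weight x * - form x)
        ≡⟨ sum-cong-≗ (λ x → solve 2 (λ a b → a :* :- b := (:- con 1ℚ) :* (a :* b)) refl (C.weight x) (form x)) ⟩
      sum (λ x → - 1ℚ * (C.weight x * form x)) ≡⟨ sum-*ˡ (- 1ℚ) (λ x → C.weight x * form x) ⟩
      - 1ℚ * sum (λ x → C.weight x * form x) ≡⟨ cong (- 1ℚ *_) (hull-value hC) ⟩
      - 1ℚ * value ≡⟨ solve 1 (λ a → (:- con 1ℚ) :* a := :- a) refl value ⟩
      - value ∎)
      (sum-nonNeg _ term)
      where open ≡-Reasoning

  term : ∀ x → 0ℚ ℚ.≤ B.weight x * form x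
  term x with x ∈? B
  ... | yes x∈B = *-nonNeg (B.nonnegative x) (ℚₚ.<⇒≤ (form-pos x∈B))
  ... | no  x∉B = ℚₚ.≤-reflexive (sym (trans (cong (_* form x) (B.supported x x∉B)) (ℚₚ.*-zeroˡ (form x))))

  wB≡0 : ∀ x → B.weight x ≡ 0ℚ
  wB≡0 x with x ∈? B
  ... | no  x∉B = B.supported x x∉B
  ... | yes x∈B = ℚₚ.≤-antisym
    (ℚₚ.*-cancelʳ-≤-pos (form x) {{ℚ.positive (form-pos x∈B)}}
      (subst (B.weight x * form x ℚ.≤_) (sym (ℚₚ.*-zeroˡ (form x)))
        (sum≤0⇒≤0 _ term (subst (ℚ._≤ 0ℚ) (sym (hull-value hB)) value≤0) x)))
    (B.nonnegative x)

δ : Fin m → Vector ℚ m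
δ zero    zero    = 1ℚ
δ zero    (suc z) = 0ℚ
δ (suc x) zero    = 0ℚ
δ (suc x) (suc z) = δ x z

δ-nonNeg : ∀ (x z : Fin m) → 0ℚ ℚ.≤ δ x z
δ-nonNeg zero    zero    = ℚₚ.nonNegative⁻¹ 1ℚ
δ-nonNeg zero    (suc z) = ℚₚ.≤-refl
δ-nonNeg (suc x) zero    = ℚₚ.≤-refl
δ-nonNeg (suc x) (suc z) = δ-nonNeg x z

δ-off : ∀ {x z : Fin m} → x ≢ z → δ x z ≡ 0ℚ
δ-off {x = zero}  {zero}  x≢z = contradiction refl x≢z
δ-off {x = zero}  {suc z} x≢z = refl
δ-off {x = suc x} {zero}  x≢z = refl
δ-off {x = suc x} {suc z} x≢z = δ-off (x≢z ∘ cong suc)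

sum-δ : ∀ (g : Vector ℚ m) x → sum (λ z → g z * δ x z) ≡ g x
sum-δ g zero = begin
  g zero * 1ℚ + sum (λ z → g (suc z) * 0ℚ)
    ≡⟨ cong₂ _+_ (ℚₚ.*-identityʳ (g zero)) (sum-zero _ (λ z → ℚₚ.*-zeroʳ (g (suc z)))) ⟩
  g zero + 0ℚ ≡⟨ ℚₚ.+-identityʳ (g zero) ⟩
  g zero      ∎
  where open ≡-Reasoning
sum-δ g (suc x) = begin
  g zero * 0ℚ + sum (λ z → g (suc z) * δ x z) ≡⟨ cong₂ _+_ (ℚₚ.*-zeroʳ (g zero)) (sum-δ (g ∘ suc) x) ⟩
  0ℚ + g (suc x)                              ≡⟨ ℚₚ.+-identityˡ (g (suc x)) ⟩
  g (suc x)                                   ∎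
  where open ≡-Reasoning

segment∈hull : ∀ {B : Subset m} {x y} → x ∈ B → y ∈ B → ∀ {α β} → 0ℚ ℚ.≤ α → 0ℚ ℚ.≤ β → α + β ≡ 1ℚ →
               ConvexHull B (α * abscissa x + β * abscissa y , α * ordinate x + β * ordinate y)
segment∈hull {B = B} {x} {y} x∈B y∈B {α} {β} 0≤α 0≤β α+β≡1 = record
  { weight      = weight
  ; nonnegative = λ z → ℚₚ.+-mono-≤ (ℚₚ.+-mono-≤ (ℚₚ.≤-refl {0ℚ}) (*-nonNeg 0≤α (δ-nonNeg x z))) (*-nonNeg 0≤β (δ-nonNeg y z))
  ; supported   = λ z z∉B → cong₂ (λ a b → 0ℚ + a + b)
      (trans (cong (α *_) (δ-off {x = x} {z} (λ x≡z → z∉B (subst (_∈ B) x≡z x∈B)))) (ℚₚ.*-zeroʳ α))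
      (trans (cong (β *_) (δ-off {x = y} {z} (λ y≡z → z∉B (subst (_∈ B) y≡z y∈B)))) (ℚₚ.*-zeroʳ β))
  ; total       = begin
      sum weight                       ≡⟨ sum-cong-≗ (λ z → sym (ℚₚ.*-identityʳ (weight z))) ⟩
      sum (λ z → weight z * 1ℚ)        ≡⟨ integrate (λ _ → 1ℚ) ⟩
      α * 1ℚ + β * 1ℚ                  ≡⟨ cong₂ _+_ (ℚₚ.*-identityʳ α) (ℚₚ.*-identityʳ β) ⟩
      α + β                            ≡⟨ α+β≡1 ⟩
      1ℚ                               ∎
  ; abscissa    = integrate abscissa
  ; ordinate    = integrate ordinate
  }
  where
  open ≡-Reasoning
  weight : Vector ℚ _
  -- The summand `0ℚ` gives the weight the shape of an affine form, so that `sum-affine` evaluates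
  -- all the required sums, with weight and integrand exchanged.
  weight z = 0ℚ + α * δ x z + β * δ y z
  integrate : ∀ g → sum (λ z → weight z * g z) ≡ α * g x + β * g y
  integrate g = begin
    sum (λ z → weight z * g z)  ≡⟨ sum-cong-≗ (λ z → ℚₚ.*-comm (weight z) (g z)) ⟩
    sum (λ z → g z * weight z)  ≡⟨ sum-affine 0ℚ α β g (δ x) (δ y) ⟩
    0ℚ * sum g + α * sum (λ z → g z * δ x z) + β * sum (λ z → g z * δ y z)
      ≡⟨ cong₂ _+_ (cong₂ _+_ (ℚₚ.*-zeroˡ (sum g)) (cong (α *_) (sum-δ g x))) (cong (β *_) (sum-δ g y)) ⟩
    0ℚ + α * g x + β * g y      ≡⟨ cong (_+ β * g y) (ℚₚ.+-identityˡ (α * g x)) ⟩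
    α * g x + β * g y           ∎

-- The third divided difference of a polynomial of degree at most two vanishes;
-- its positive and negative coefficients weight the end points of the two
-- crossing chords.
module DividedDifference (A B C D : ℚ) where
  open +-*-Solver

  Dᵃ Dᵇ Dᶜ Dᵈ : ℚ
  Dᵃ = (C - B) * (D - B) * (D - C)
  Dᵇ = (C - A) * (D - A) * (D - C)
  Dᶜ = (B - A) * (D - A) * (D - B)
  Dᵈ = (B - A) * (C - A) * (C - B)

  vanish : ∀ k₀ k₁ k₂ →
    Dᵃ * (k₀ + k₁ * A + k₂ * (A * A)) + Dᶜ * (k₀ + k₁ * C + k₂ * (C * C)) ≡
    Dᵇ * (k₀ + k₁ * B + k₂ * (B * B)) + Dᵈ * (k₀ + k₁ * D + k₂ * (D * D))
  vanish = solve 7 (λ A B C D k₀ k₁ k₂ →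
    (C :- B) :* (D :- B) :* (D :- C) :* (k₀ :+ k₁ :* A :+ k₂ :* (A :* A)) :+
    (B :- A) :* (D :- A) :* (D :- B) :* (k₀ :+ k₁ :* C :+ k₂ :* (C :* C)) :=
    (C :- A) :* (D :- A) :* (D :- C) :* (k₀ :+ k₁ :* B :+ k₂ :* (B :* B)) :+
    (B :- A) :* (C :- A) :* (C :- B) :* (k₀ :+ k₁ :* D :+ k₂ :* (D :* D))) refl A B C D

-- Multiplied by 1 + T², each coordinate is a polynomial of degree at most two in the parameter T.
-- So the divided-difference coefficients, scaled by `N` and normalised, express one and the same
-- point through `a`, `c` and through `b`, `d`.
chords-cross : ∀ {P Q : Subset m} {a b c d} → a Fin.< b → b Fin.< c → c Fin.< d →
               a ∈ P → c ∈ P → b ∈ Q → d ∈ Q → ∃ λ p → ConvexHull P p × ConvexHull Q p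
chords-cross {P = P} {Q} {a} {b} {c} {d} a<b b<c c<d a∈P c∈P b∈Q d∈Q =
  _ , segment∈hull a∈P c∈P (ℚₚ.<⇒≤ (pos 0<Dᵃ a)) (ℚₚ.<⇒≤ (pos 0<Dᶜ c)) total ,
  subst (ConvexHull Q) (sym (cong₂ _,_ same-abscissa same-ordinate))
    (segment∈hull b∈Q d∈Q (ℚₚ.<⇒≤ (pos 0<Dᵇ b)) (ℚₚ.<⇒≤ (pos 0<Dᵈ d)) total′)
  where
  A = parameter a
  B = parameter b
  C = parameter c
  D = parameter d
  open DividedDifference A B C D
  open ≡-Reasoning
  open +-*-Solver
  a<c = ℕₚ.<-trans a<b b<c
  b<d = ℕₚ.<-trans b<c c<d
  a<d = ℕₚ.<-trans a<c c<d
  0<Dᵃ = *-pos (*-pos (ι-gap-pos b<c) (ι-gap-pos b<d)) (ι-gap-pos c<d)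
  0<Dᵇ = *-pos (*-pos (ι-gap-pos a<c) (ι-gap-pos a<d)) (ι-gap-pos c<d)
  0<Dᶜ = *-pos (*-pos (ι-gap-pos a<b) (ι-gap-pos a<d)) (ι-gap-pos b<d)
  0<Dᵈ = *-pos (*-pos (ι-gap-pos a<b) (ι-gap-pos a<c)) (ι-gap-pos b<c)

  N : Fin _ → ℚ
  N x = 1ℚ + parameter x * parameter x

  S : ℚ
  S = Dᵃ * N a + Dᶜ * N c

  0<S : 0ℚ ℚ.< S
  0<S = ℚₚ.+-mono-< (*-pos 0<Dᵃ (0<1+T² a)) (*-pos 0<Dᶜ (0<1+T² c))

  instance
    S-pos : ℚ.Positive S
    S-pos = ℚ.positive 0<S
    S-nonZero : ℚ.NonZero S
    S-nonZero = ℚₚ.pos⇒nonZero S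

  s : ℚ
  s = ℚ.1/ S

  0<s : 0ℚ ℚ.< s
  0<s = ℚₚ.positive⁻¹ s {{ℚₚ.1/pos⇒pos S}}

  pos : ∀ {Dˣ} → 0ℚ ℚ.< Dˣ → ∀ x → 0ℚ ℚ.< Dˣ * N x * s
  pos 0<D x = *-pos (*-pos 0<D (0<1+T² x)) 0<s

  -- The quadratic 1 + T² itself is balanced, so both chords carry the same total weight and one
  -- normalisation serves for both.
  S≡ : S ≡ Dᵇ * N b + Dᵈ * N d
  S≡ = begin
    Dᵃ * N a + Dᶜ * N c ≡⟨ cong₂ (λ p q → Dᵃ * p + Dᶜ * q) (quadratic A) (quadratic C) ⟩
    _                   ≡⟨ vanish 1ℚ 0ℚ 1ℚ ⟩
    _                   ≡⟨ cong₂ (λ p q → Dᵇ * p + Dᵈ * q) (quadratic B) (quadratic D) ⟨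
    Dᵇ * N b + Dᵈ * N d ∎
    where
    quadratic : ∀ T → 1ℚ + T * T ≡ 1ℚ + 0ℚ * T + 1ℚ * (T * T)
    quadratic = solve 1 (λ T → con 1ℚ :+ T :* T := con 1ℚ :+ con 0ℚ :* T :+ con 1ℚ :* (T :* T)) refl

  factor : ∀ u v w → u * w + v * w ≡ (u + v) * w
  factor u v w = sym (ℚₚ.*-distribʳ-+ w u v)

  total : Dᵃ * N a * s + Dᶜ * N c * s ≡ 1ℚ
  total = trans (factor (Dᵃ * N a) (Dᶜ * N c) s) (ℚₚ.*-inverseʳ S)

  total′ : Dᵇ * N b * s + Dᵈ * N d * s ≡ 1ℚ
  total′ = trans (factor (Dᵇ * N b) (Dᵈ * N d) s) (trans (cong (_* s) (sym S≡)) (ℚₚ.*-inverseʳ S))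

  balance : ∀ k₀ k₁ k₂ (g : Fin _ → ℚ) →
            (∀ x → g x * N x ≡ k₀ + k₁ * parameter x + k₂ * (parameter x * parameter x)) →
            Dᵃ * N a * s * g a + Dᶜ * N c * s * g c ≡ Dᵇ * N b * s * g b + Dᵈ * N d * s * g d
  balance k₀ k₁ k₂ g g-eq = begin
    Dᵃ * N a * s * g a + Dᶜ * N c * s * g c           ≡⟨ regroup Dᵃ Dᶜ (N a) (N c) (g a) (g c) s ⟩
    (Dᵃ * (g a * N a) + Dᶜ * (g c * N c)) * s         ≡⟨ cong₂ (λ p q → (Dᵃ * p + Dᶜ * q) * s) (g-eq a) (g-eq c) ⟩
    _                                                 ≡⟨ cong (_* s) (vanish k₀ k₁ k₂) ⟩
    _                                                 ≡⟨ cong₂ (λ p q → (Dᵇ * p + Dᵈ * q) * s) (g-eq b) (g-eq d) ⟨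
    (Dᵇ * (g b * N b) + Dᵈ * (g d * N d)) * s         ≡⟨ regroup Dᵇ Dᵈ (N b) (N d) (g b) (g d) s ⟨
    Dᵇ * N b * s * g b + Dᵈ * N d * s * g d           ∎
    where
    regroup : ∀ e e′ n n′ h h′ s → e * n * s * h + e′ * n′ * s * h′ ≡ (e * (h * n) + e′ * (h′ * n′)) * s
    regroup = solve 7 (λ e e′ n n′ h h′ s →
      e :* n :* s :* h :+ e′ :* n′ :* s :* h′ := (e :* (h :* n) :+ e′ :* (h′ :* n′)) :* s) refl

  same-abscissa = balance 1ℚ 0ℚ (- 1ℚ) abscissa λ x → trans (abscissa-eq x)
    (solve 1 (λ T → con 1ℚ :- T :* T := con 1ℚ :+ con 0ℚ :* T :+ con (- 1ℚ) :* (T :* T)) refl (parameter x))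
  same-ordinate = balance 0ℚ (- (1ℚ + 1ℚ)) 0ℚ ordinate λ x → trans (ordinate-eq x)
    (solve 1 (λ T → :- (T :+ T) := con 0ℚ :+ con (- (1ℚ + 1ℚ)) :* T :+ con 0ℚ :* (T :* T)) refl (parameter x))

abstract
  least : {P : Pred (Fin m) 0ℓ} → Decidable P → ∃ P → ∃ λ x → P x × (∀ {y} → P y → x Fin.≤ y)
  least {suc m} P? w with P? zero
  ... | yes p = zero , p , λ _ → z≤n
  least {suc m} P? (zero  , p) | no ¬p = contradiction p ¬p
  least {suc m} P? (suc w , p) | no ¬p with x , px , x≤ ← least (P? ∘ suc) (w , p) =
    suc x , px , λ { {zero} p → contradiction p ¬p ; {suc y} p → s≤s (x≤ p) }

abstract
  greatest : {P : Pred (Fin m) 0ℓ} → Decidable P → ∃ P → ∃ λ x → P x × (∀ {y} → P y → y Fin.≤ x)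
  greatest {suc m} P? w with Finₚ.any? (P? ∘ suc)
  ... | yes w′ with x , px , ≤x ← greatest (P? ∘ suc) w′ =
    suc x , px , λ { {zero} _ → z≤n ; {suc y} p → s≤s (≤x p) }
  greatest {suc m} P? (zero  , p) | no ¬w = zero , p , λ { {zero} _ → z≤n ; {suc y} p → contradiction (y , p) ¬w }
  greatest {suc m} P? (suc w , p) | no ¬w = contradiction (w , p) ¬w

-- Partitions as equivalence relations without crossings

infix 4 _∋_~_ _∋_~?_

_∋_~_ : Partition m → Fin m → Fin m → Set
σ ∋ a ~ b = b ∈ block σ a

_∋_~?_ : (σ : Partition m) → ∀ a b → Dec (σ ∋ a ~ b)
σ ∋ a ~? b = b ∈? block σ a

~-refl : (σ : Partition m) → ∀ {a} → σ ∋ a ~ a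
~-refl σ@(mkPartition _ covering _) {a} = recompute (σ ∋ a ~? a) (covering a)

block-cong : (σ : Partition m) → ∀ {a b} → σ ∋ a ~ b → block σ a ≡ block σ b
block-cong σ@(mkPartition _ _ disjoint) {a} {b} a~b =
  recompute (Vecₚ.≡-dec Boolₚ._≟_ (block σ a) (block σ b)) (disjoint a b b a~b (~-refl σ))

~-sym : (σ : Partition m) → ∀ {a b} → σ ∋ a ~ b → σ ∋ b ~ a
~-sym σ {a} a~b = subst (a ∈_) (block-cong σ a~b) (~-refl σ)

~-trans : (σ : Partition m) → ∀ {a b c} → σ ∋ a ~ b → σ ∋ b ~ c → σ ∋ a ~ c
~-trans σ {c = c} a~b b~c = subst (c ∈_) (sym (block-cong σ a~b)) b~c

module _ {R : Rel (Fin m) 0ℓ} (R? : Decidable₂ R) (equivalence : IsEquivalence R) where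
  private
    module R = IsEquivalence equivalence

    relation : Vec (Subset m) m
    relation = tabulate λ a → tabulate λ b → does (R? a b)

    lookup-relation : ∀ a b → lookup (lookup relation a) b ≡ does (R? a b)
    lookup-relation a b = trans (cong (flip lookup b) (Vecₚ.lookup∘tabulate _ a)) (Vecₚ.lookup∘tabulate _ b)

    R⇒∈ : ∀ {a b} → R a b → b ∈ lookup relation a
    R⇒∈ {a} {b} r = Vecₚ.lookup⇒[]= b _ (trans (lookup-relation a b) does≡true)
      where
      does≡true : does (R? a b) ≡ true
      does≡true with R? a b
      ... | yes _ = refl
      ... | no ¬r = contradiction r ¬r

    ∈⇒R : ∀ {a b} → b ∈ lookup relation a → R a b
    ∈⇒R {a} {b} b∈ with R? a b | trans (sym (lookup-relation a b)) (Vecₚ.[]=⇒lookup b∈)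
    ... | yes r | _ = r

  fromRelation : Partition m
  fromRelation = mkPartition relation (λ x → R⇒∈ R.refl) λ x y z z∈x z∈y →
    ⊆-antisym (λ w∈x → R⇒∈ (R.trans (R.trans (∈⇒R z∈y) (R.sym (∈⇒R z∈x))) (∈⇒R w∈x)))
              (λ w∈y → R⇒∈ (R.trans (R.trans (∈⇒R z∈x) (R.sym (∈⇒R z∈y))) (∈⇒R w∈y)))

  fromRelation⁺ : ∀ {a b} → R a b → fromRelation ∋ a ~ b
  fromRelation⁺ = R⇒∈

  fromRelation⁻ : ∀ {a b} → fromRelation ∋ a ~ b → R a b
  fromRelation⁻ = ∈⇒R

Uncrossed : Pred (Partition m) 0ℓ
Uncrossed σ = ∀ {a b c d} → a Fin.< b → b Fin.< c → c Fin.< d → σ ∋ a ~ c → σ ∋ b ~ d → σ ∋ a ~ b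

-- The noncrossing proof is irrelevant and can only be used to derive an absurdity; deciding `a ~ b`
-- beforehand leaves just that.
uncrossed : (x : NC m) → Uncrossed (partition x)
uncrossed (mkNC σ noncrossing) {a} {b} a<b b<c c<d a~c b~d with σ ∋ a ~? b
... | yes a~b = a~b
... | no  a≁b = ⊥-elim-irr (noncrossing (a , refl) (b , refl)
  (λ eq → a≁b (subst (b ∈_) (sym eq) (~-refl σ))) (proj₁ crossing) (proj₂ crossing))
  where crossing = chords-cross a<b b<c c<d (~-refl σ) a~c (~-refl σ) b~d

-- Of two blocks, the one with the larger least element spans an interval. An element of the other
-- block inside that interval would cross it, together with the smaller least element. So the other
-- block stays outside and the chord between the ends of the interval separates the hulls.
uncrossed⇒noncrossing : (σ : Partition m) → Uncrossed σ → Noncrossing σ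
uncrossed⇒noncrossing σ unX (x , refl) (y , refl) B≢C p (p∈B , p∈C) =
  by-least (least (σ ∋ x ~?_) (x , ~-refl σ)) (least (σ ∋ y ~?_) (y , ~-refl σ))
  where
  x≁y : ¬ σ ∋ x ~ y
  x≁y = B≢C ∘ block-cong σ

  Least : Fin _ → Set
  Least x = ∃ λ l → σ ∋ x ~ l × (∀ {z} → σ ∋ x ~ z → l Fin.≤ z)

  nested : ∀ {x y} → ¬ σ ∋ x ~ y → ((l , _) : Least x) ((l′ , _) : Least y) → l Fin.< l′ →
           ∀ p → ¬ (ConvexHull (block σ x) p × ConvexHull (block σ y) p)
  nested {x} {y} x≁y (l , x~l , l≤) (l′ , y~l′ , l′≤) l<l′ with greatest (σ ∋ y ~?_) (y , ~-refl σ)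
  ... | g , y~g , ≤g = hulls-disjoint l′ g (λ y~c → l′≤ y~c , ≤g y~c) outside (l′≤ y~g)
    where
    outside : ∀ {b} → σ ∋ x ~ b → b Fin.< l′ ⊎ g Fin.< b
    outside {b} x~b with Finₚ.<-cmp b l′ | Finₚ.<-cmp b g
    ... | tri< b<l′ _ _ | _ = inj₁ b<l′
    ... | tri≈ _ refl _ | _ = contradiction (~-trans σ x~b (~-sym σ y~l′)) x≁y
    ... | _ | tri> _ _ g<b = inj₂ g<b
    ... | _ | tri≈ _ refl _ = contradiction (~-trans σ x~b (~-sym σ y~g)) x≁y
    ... | tri> _ _ l′<b | tri< b<g _ _ = contradiction
      (~-trans σ x~l (~-trans σ
        (unX l<l′ l′<b b<g (~-trans σ (~-sym σ x~l) x~b) (~-trans σ (~-sym σ y~l′) y~g))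
        (~-sym σ y~l′))) x≁y

  by-least : Least x → Least y → ⊥
  by-least lx@(l , x~l , _) ly@(l′ , y~l′ , _) with Finₚ.<-cmp l l′
  ... | tri< l<l′ _ _ = nested x≁y lx ly l<l′ p (p∈B , p∈C)
  ... | tri> _ _ l′<l = nested (x≁y ∘ ~-sym σ) ly lx l′<l p (p∈C , p∈B)
  ... | tri≈ _ refl _ = x≁y (~-trans σ x~l (~-sym σ y~l′))

toNC : (σ : Partition m) → Uncrossed σ → NC m
toNC σ unX = mkNC σ (uncrossed⇒noncrossing σ unX)

-- Merging blocks

infix 4 _~[_]_ _~[_]?_

_~[_]_ : Fin m → NC m → Fin m → Set
a ~[ x ] b = partition x ∋ a ~ b

_~[_]?_ : ∀ a (x : NC m) b → Dec (a ~[ x ] b)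
a ~[ x ]? b = partition x ∋ a ~? b

reflexive : ∀ (x : NC m) {a} → a ~[ x ] a
reflexive x = ~-refl (partition x)

symmetric : ∀ (x : NC m) {a b} → a ~[ x ] b → b ~[ x ] a
symmetric x = ~-sym (partition x)

transitive : ∀ (x : NC m) {a b c} → a ~[ x ] b → b ~[ x ] c → a ~[ x ] c
transitive x = ~-trans (partition x)

-- A chord inside one block has every other block entirely on one side; this is the form of
-- `Uncrossed` that merging needs.
no-separation : ∀ (x : NC m) {w w′ p q} → w ~[ x ] w′ → p ~[ x ] q → ¬ w ~[ x ] p →
                w Fin.< p → p Fin.< w′ → w Fin.< q × q Fin.< w′
no-separation x {w} {w′} {p} {q} w~w′ p~q w≁p w<p p<w′ = left , right
  where
  w≁q : ¬ w ~[ x ] q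
  w≁q w~q = w≁p (transitive x w~q (symmetric x p~q))
  left : w Fin.< q
  left with Finₚ.<-cmp w q
  ... | tri< w<q _ _ = w<q
  ... | tri≈ _ refl _ = contradiction (reflexive x) w≁q
  ... | tri> _ _ q<w = contradiction (symmetric x (uncrossed x q<w w<p p<w′ (symmetric x p~q) w~w′)) w≁q
  right : q Fin.< w′
  right with Finₚ.<-cmp q w′
  ... | tri< q<w′ _ _ = q<w′
  ... | tri≈ _ refl _ = contradiction w~w′ w≁q
  ... | tri> _ _ w′<q = contradiction (uncrossed x w<p p<w′ w′<q w~w′ p~q) w≁p

module _ (x : NC m) (u v : Fin m) where

  InMerged : Pred (Fin m) 0ℓ
  InMerged a = u ~[ x ] a ⊎ v ~[ x ] a

  Merged : Rel (Fin m) 0ℓ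
  Merged a b = a ~[ x ] b ⊎ (InMerged a × InMerged b)

  private
    inMerged-resp : ∀ {a b} → a ~[ x ] b → InMerged a → InMerged b
    inMerged-resp a~b (inj₁ u~a) = inj₁ (transitive x u~a a~b)
    inMerged-resp a~b (inj₂ v~a) = inj₂ (transitive x v~a a~b)

    merged-sym : ∀ {a b} → Merged a b → Merged b a
    merged-sym (inj₁ a~b)       = inj₁ (symmetric x a~b)
    merged-sym (inj₂ (ma , mb)) = inj₂ (mb , ma)

    merged-trans : ∀ {a b c} → Merged a b → Merged b c → Merged a c
    merged-trans (inj₁ a~b)       (inj₁ b~c)       = inj₁ (transitive x a~b b~c)
    merged-trans (inj₁ a~b)       (inj₂ (mb , mc)) = inj₂ (inMerged-resp (symmetric x a~b) mb , mc)
    merged-trans (inj₂ (ma , mb)) (inj₁ b~c)       = inj₂ (ma , inMerged-resp b~c mb)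
    merged-trans (inj₂ (ma , mb)) (inj₂ (_ , mc))  = inj₂ (ma , mc)

  inMerged? : Decidable InMerged
  inMerged? a = (u ~[ x ]? a) ⊎-dec (v ~[ x ]? a)

  merged? : Decidable₂ Merged
  merged? a b = (a ~[ x ]? b) ⊎-dec (inMerged? a ×-dec inMerged? b)

  merged-equivalence : IsEquivalence Merged
  merged-equivalence = record
    { refl = inj₁ (reflexive x) ; sym = merged-sym ; trans = merged-trans }

  record IsMerge (z : NC m) : Set where
    field
      merge⁺ : ∀ {a b} → Merged a b → a ~[ z ] b
      merge⁻ : ∀ {a b} → a ~[ z ] b → Merged a b

    coarser : x ≤ᴺ z
    coarser _ = merge⁺ ∘ inj₁

    joined : u ~[ z ] v
    joined = merge⁺ (inj₂ (inj₁ (reflexive x) , inj₂ (reflexive x)))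

    minimal : ∀ {ρ} → x ≤ᴺ ρ → u ~[ ρ ] v → z ≤ᴺ ρ
    minimal {ρ} x≤ρ u~v a a~b with merge⁻ a~b
    ... | inj₁ a~b       = x≤ρ a a~b
    ... | inj₂ (ma , mb) = transitive ρ (symmetric ρ (u~ ma)) (u~ mb)
      where
      u~ : ∀ {c} → InMerged c → u ~[ ρ ] c
      u~ (inj₁ u~c) = x≤ρ u u~c
      u~ (inj₂ v~c) = transitive ρ u~v (x≤ρ v v~c)

    merge-covers : ¬ u ~[ x ] v → x ⋖ z
    merge-covers u≁v = coarser , (λ { refl → u≁v joined }) , between
      where
      between : ∀ ρ → x ≤ᴺ ρ → ρ ≤ᴺ z → ρ ≡ x ⊎ ρ ≡ z
      between ρ x≤ρ ρ≤z with u ~[ ρ ]? v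
      ... | yes u~v = inj₂ (≤ᴺ-antisym ρ≤z (minimal {ρ} x≤ρ u~v))
      ... | no  u≁ρv = inj₁ (≤ᴺ-antisym ρ≤x x≤ρ)
        where
        ρ≤x : ρ ≤ᴺ x
        ρ≤x a {b} a~ρb with merge⁻ (ρ≤z a a~ρb)
        ... | inj₁ a~b = a~b
        ... | inj₂ (inj₁ u~a , inj₁ u~b) = transitive x (symmetric x u~a) u~b
        ... | inj₂ (inj₂ v~a , inj₂ v~b) = transitive x (symmetric x v~a) v~b
        ... | inj₂ (inj₁ u~a , inj₂ v~b) = contradiction
          (transitive ρ (x≤ρ u u~a) (transitive ρ a~ρb (symmetric ρ (x≤ρ v v~b)))) u≁ρv
        ... | inj₂ (inj₂ v~a , inj₁ u~b) = contradiction
          (transitive ρ (x≤ρ u u~b) (transitive ρ (symmetric ρ a~ρb) (symmetric ρ (x≤ρ v v~a)))) u≁ρv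

    block-∪ : block (partition x) u ∪ block (partition x) v ≡ block (partition z) u
    block-∪ = ⊆-antisym
      (λ w∈ → merge⁺ (inj₂ (inj₁ (reflexive x) , x∈p∪q⁻ (block (partition x) u) _ w∈)))
      (λ u~w → x∈p∪q⁺ (in-union (merge⁻ u~w)))
      where
      in-union : ∀ {w} → Merged u w → InMerged w
      in-union (inj₁ u~w)      = inj₁ u~w
      in-union (inj₂ (_ , mw)) = mw

  module _ {y : NC m} (x≤y : x ≤ᴺ y) (u~v : u ~[ y ] v)
    (u-v-unseparated : ∀ {w w′} → w ~[ x ] w′ → u ~[ y ] w → ¬ u ~[ x ] w → ¬ v ~[ x ] w →
      (w Fin.< u → u Fin.< w′ → w Fin.< v × v Fin.< w′) ×
      (w Fin.< v → v Fin.< w′ → w Fin.< u × u Fin.< w′)) where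

    private
      u~ : ∀ {c} → InMerged c → u ~[ y ] c
      u~ (inj₁ u~c) = x≤y u u~c
      u~ (inj₂ v~c) = transitive y u~v (x≤y v v~c)

      -- A chord outside the block of `u` in `y` belongs to another block of `y`, so it cannot
      -- separate `p` from `q`. For a chord inside that block, `p` is traded for whichever of `u`
      -- and `v` shares its block in `x`, the hypothesis transfers the side between `u` and `v`, and
      -- a second trade leads to `q`.
      unseparated : ∀ {w w′ p q} → w ~[ x ] w′ → ¬ InMerged w → InMerged p → InMerged q →
                    w Fin.< p → p Fin.< w′ → w Fin.< q × q Fin.< w′
      unseparated {w} {w′} {p} {q} w~w′ ¬mw mp mq w<p p<w′ with u ~[ y ]? w
      ... | no u≁w = no-separation y (x≤y w w~w′) (transitive y (symmetric y (u~ mp)) (u~ mq))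
        (λ w~p → u≁w (transitive y (u~ mp) (symmetric y w~p))) w<p p<w′
      ... | yes u~w = from-uv mq (to-uv mp)
        where
        u≁w = ¬mw ∘ inj₁
        v≁w = ¬mw ∘ inj₂
        u↔v = u-v-unseparated w~w′ u~w u≁w v≁w
        Around : Pred (Fin m) 0ℓ
        Around a = w Fin.< a × a Fin.< w′
        around-u : Around u ⊎ Around v → Around u
        around-u (inj₁ au) = au
        around-u (inj₂ (w<v , v<w′)) = proj₂ u↔v w<v v<w′
        around-v : Around u ⊎ Around v → Around v
        around-v (inj₁ (w<u , u<w′)) = proj₁ u↔v w<u u<w′
        around-v (inj₂ av) = av
        to-uv : InMerged p → Around u ⊎ Around v
        to-uv (inj₁ u~p) = inj₁ (no-separation x w~w′ (symmetric x u~p)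
          (λ w~p → u≁w (transitive x u~p (symmetric x w~p))) w<p p<w′)
        to-uv (inj₂ v~p) = inj₂ (no-separation x w~w′ (symmetric x v~p)
          (λ w~p → v≁w (transitive x v~p (symmetric x w~p))) w<p p<w′)
        from-uv : InMerged q → Around u ⊎ Around v → Around q
        from-uv (inj₁ u~q) uv with au ← around-u uv =
          no-separation x w~w′ u~q (u≁w ∘ symmetric x) (proj₁ au) (proj₂ au)
        from-uv (inj₂ v~q) uv with av ← around-v uv =
          no-separation x w~w′ v~q (v≁w ∘ symmetric x) (proj₁ av) (proj₂ av)

      merged-uncrossed : Uncrossed (fromRelation merged? merged-equivalence)
      merged-uncrossed {a} {b} {c} {d} a<b b<c c<d a~c b~d =
        fromRelation⁺ merged? merged-equivalence
          (cases (fromRelation⁻ merged? merged-equivalence a~c) (fromRelation⁻ merged? merged-equivalence b~d))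
        where
        cases : Merged a c → Merged b d → Merged a b
        cases (inj₁ a~c)      (inj₁ b~d)      = inj₁ (uncrossed x a<b b<c c<d a~c b~d)
        cases (inj₂ (ma , _)) (inj₂ (mb , _)) = inj₂ (ma , mb)
        cases (inj₁ a~c) (inj₂ (mb , md)) with inMerged? a
        ... | yes ma = inj₂ (ma , mb)
        ... | no ¬ma = contradiction (proj₂ (unseparated a~c ¬ma mb md a<b b<c)) (ℕₚ.<-asym c<d)
        cases (inj₂ (ma , mc)) (inj₁ b~d) with inMerged? b
        ... | yes mb = inj₂ (ma , mb)
        ... | no ¬mb = contradiction (proj₁ (unseparated b~d ¬mb mc ma b<c c<d)) (ℕₚ.<-asym a<b)

    ∃-merge : ∃ λ z → IsMerge z × z ≤ᴺ y
    ∃-merge = z , isMerge , IsMerge.minimal isMerge {y} x≤y u~v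
      where
      z = toNC (fromRelation merged? merged-equivalence) merged-uncrossed
      isMerge : IsMerge z
      isMerge = record
        { merge⁺ = fromRelation⁺ merged? merged-equivalence
        ; merge⁻ = fromRelation⁻ merged? merged-equivalence
        }

open IsMerge

module _ {x z : NC m} {k} (cover : x ⋖ z) (isLabel : IsLabel x z k) where
  open IsLabel isLabel

  private
    u = proj₁ B₁-block
    v = proj₁ B₂-block

    ∈B₁ : ∀ {a} → u ~[ x ] a → a ∈ B₁
    ∈B₁ {a} = subst (a ∈_) (sym (proj₂ B₁-block))

    ∈B₂ : ∀ {a} → v ~[ x ] a → a ∈ B₂
    ∈B₂ {a} = subst (a ∈_) (sym (proj₂ B₂-block))

    merged-block : ∀ {a} → a ∈ B₁ ∪ B₂ → proj₁ merged ~[ z ] a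
    merged-block {a} = subst (a ∈_) (proj₂ merged)

    u-merged : proj₁ merged ~[ z ] u
    u-merged = merged-block (x∈p∪q⁺ (inj₁ (∈B₁ (reflexive x))))

    u~v : u ~[ z ] v
    u~v = transitive z (symmetric z u-merged) (merged-block (x∈p∪q⁺ (inj₂ (∈B₂ (reflexive x)))))

    same-block : ∀ {w} → u ~[ z ] w → InMerged x u v w
    same-block {w} u~w with x∈p∪q⁻ B₁ B₂ (subst (w ∈_) (sym (proj₂ merged)) (transitive z u-merged u~w))
    ... | inj₁ w∈B₁ = inj₁ (subst (w ∈_) (proj₂ B₁-block) w∈B₁)
    ... | inj₂ w∈B₂ = inj₂ (subst (w ∈_) (proj₂ B₂-block) w∈B₂)

  -- The union of `B₁` and `B₂` contains no third block of `x`, so the separation hypothesis of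
  -- `∃-merge` holds vacuously. The resulting merge lies between `x` and `z`, and the covering
  -- relation identifies it with `z`.
  labelled-merge : ∃₂ λ u v → B₁ ≡ block (partition x) u × B₂ ≡ block (partition x) v × IsMerge x u v z
  labelled-merge = u , v , proj₂ B₁-block , proj₂ B₂-block , isMerge
    where
    isMerge : IsMerge x u v z
    isMerge with ∃-merge x u v {z} (proj₁ cover) u~v (λ _ u~w u≁w v≁w → contradiction (same-block u~w) [ u≁w , v≁w ]′)
    ... | ρ , isMerge , ρ≤z with proj₂ (proj₂ cover) ρ (coarser isMerge) ρ≤z
    ...   | inj₂ refl = isMerge
    ...   | inj₁ refl = contradiction
      (trans (proj₂ B₁-block) (trans (block-cong (partition x) (joined isMerge)) (sym (proj₂ B₂-block)))) B₁≢B₂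

-- Parking functions

count : {P : Pred (Fin m) 0ℓ} → Decidable P → ℕ
count {zero}  P? = 0
count {suc m} P? with P? zero
... | yes _ = suc (count (P? ∘ suc))
... | no  _ = count (P? ∘ suc)

count-cong : {P Q : Pred (Fin m) 0ℓ} (P? : Decidable P) (Q? : Decidable Q) →
             (∀ {a} → P a → Q a) → (∀ {a} → Q a → P a) → count P? ≡ count Q?
count-cong {zero}  P? Q? P⇒Q Q⇒P = refl
count-cong {suc m} P? Q? P⇒Q Q⇒P with P? zero | Q? zero
... | yes _ | yes _ = cong suc (count-cong (P? ∘ suc) (Q? ∘ suc) P⇒Q Q⇒P)
... | no  _ | no  _ = count-cong (P? ∘ suc) (Q? ∘ suc) P⇒Q Q⇒P
... | yes p | no ¬q = contradiction (P⇒Q p) ¬q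
... | no ¬p | yes q = contradiction (Q⇒P q) ¬p

count-none : {P : Pred (Fin m) 0ℓ} (P? : Decidable P) → (∀ {a} → ¬ P a) → count P? ≡ 0
count-none {zero}  P? ¬P = refl
count-none {suc m} P? ¬P with P? zero
... | yes p = contradiction p ¬P
... | no  _ = count-none (P? ∘ suc) ¬P

count-remove : {P Q : Pred (Fin m) 0ℓ} (P? : Decidable P) (Q? : Decidable Q) → ∀ {v} → P v → ¬ Q v →
               (∀ {a} → P a → a ≢ v → Q a) → (∀ {a} → Q a → P a) → count P? ≡ suc (count Q?)
count-remove {suc m} P? Q? {zero} pv ¬qv P⇒Q Q⇒P with P? zero | Q? zero
... | no ¬p | _     = contradiction pv ¬p
... | _     | yes q = contradiction q ¬qv
... | yes _ | no _  = cong suc (count-cong (P? ∘ suc) (Q? ∘ suc) (λ p → P⇒Q p λ ()) Q⇒P)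
count-remove {suc m} P? Q? {suc v} pv ¬qv P⇒Q Q⇒P
  with P? zero | Q? zero | count-remove (P? ∘ suc) (Q? ∘ suc) pv ¬qv (λ p a≢v → P⇒Q p (a≢v ∘ Finₚ.suc-injective)) Q⇒P
... | yes _ | yes _ | eq = cong suc eq
... | no  _ | no  _ | eq = eq
... | yes p | no ¬q | _  = contradiction (P⇒Q p λ ()) ¬q
... | no ¬p | yes q | _  = contradiction (Q⇒P q) ¬p

below? : ∀ j → Decidable {A = Fin m} (λ a → toℕ a ℕ.< j)
below? j a = toℕ a ℕₚ.<? j

count-below : ∀ j → j ℕ.≤ m → count {m} (below? j) ≡ j
count-below {m}     zero    _         = count-none {m} (below? 0) λ ()
count-below {suc m} (suc j) (s≤s j≤m) =
  cong suc (trans (count-cong {m} (below? (suc j) ∘ suc) (below? j) ℕ.s≤s⁻¹ s≤s) (count-below {m} j j≤m))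

-- In a weakly increasing list the entries at most `t` form an initial segment, whose length is what
-- `filter` measures.
sorted-lookup : ∀ {t} {b : List ℕ} → AllPairs ℕ._≤_ b → ∀ i →
                toℕ i ℕ.< length (filter (ℕₚ._≤? t) b) → List.lookup b i ℕ.≤ t
sorted-lookup {t} {h ∷ b} (h≤ ∷ sorted) i i< with h ℕₚ.≤? t
sorted-lookup {t} {h ∷ b} (h≤ ∷ sorted) zero    i< | yes h≤t = h≤t
sorted-lookup {t} {h ∷ b} (h≤ ∷ sorted) (suc i) i< | yes h≤t = sorted-lookup sorted i
  (ℕ.s≤s⁻¹ (subst (λ l → suc (toℕ i) ℕ.< length l) (Listₚ.filter-accept (ℕₚ._≤? t) h≤t) i<))
sorted-lookup {t} {h ∷ b} (h≤ ∷ sorted) i i< | no h≰t =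
  contradiction (subst (toℕ i ℕ.<_) (cong length (trans (Listₚ.filter-reject (ℕₚ._≤? t) h≰t) none)) i<) λ ()
  where
  none : filter (ℕₚ._≤? t) b ≡ []
  none = Listₚ.filter-none (ℕₚ._≤? t) (All.map (λ h≤y y≤t → h≰t (ℕₚ.≤-trans h≤y y≤t)) h≤)

-- The last hypothesis is the parking condition in counting form; at `⟦ i ⟧` it places position `i`
-- in the initial segment of entries at most `⟦ i ⟧`.
isParking : ∀ {n} (a : Vec ℕ n) → (∀ i → 1 ℕ.≤ lookup a i) →
            (∀ t → t ℕ.≤ n → t ℕ.≤ length (filter (ℕₚ._≤? t) (toList a))) → IsParking a
isParking {n} a positive enough = positive , λ i → sorted-lookup (Linked⇒AllPairs ℕₚ.≤-trans (sort-↗ (toList a))) i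
  (subst (suc (toℕ i) ℕ.≤_) (sym (↭-length (filter-↭ (ℕₚ._≤? _) (sort-↭ (toList a)))))
    (enough _ (subst (suc (toℕ i) ℕ.≤_) length-sort (Finₚ.toℕ<n i))))
  where
  length-sort : length (sort (toList a)) ≡ n
  length-sort = trans (↭-length (sort-↭ (toList a))) (Vecₚ.length-toList a)

-- Each block is represented by its least element, so counting these elements counts blocks and
-- measures progress along a chain.
IsMin : NC m → Pred (Fin m) 0ℓ
IsMin x a = ∀ b → a ~[ x ] b → a Fin.≤ b

isMin? : (x : NC m) → Decidable (IsMin x)
isMin? x a = Finₚ.all? λ b → (a ~[ x ]? b) →-dec (a Finₚ.≤? b)

abstract
  block-min : ∀ (x : NC m) a → ∃ λ l → l ~[ x ] a × IsMin x l
  block-min x a with l , a~l , l≤ ← least (a ~[ x ]?_) (a , reflexive x) =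
    l , symmetric x a~l , λ b l~b → l≤ (transitive x a~l l~b)

abstract
  ¬isMin⇒ : ∀ (x : NC m) {a} → ¬ IsMin x a → ∃ λ b → b ~[ x ] a × b Fin.< a
  ¬isMin⇒ x {a} ¬min with l , l~a , min ← block-min x a =
    l , l~a , Finₚ.≤∧≢⇒< (min a l~a) (λ { refl → ¬min min })

-- Chains of merges with labels other than n

module Chains (k : ℕ) where

  n : ℕ
  n = suc (suc k)

  Element : Set
  Element = NC (suc n)

  L N : Fin (suc n)
  L = fromℕ n
  N = inject₁ (fromℕ (suc k))

  toℕ-L : toℕ L ≡ n
  toℕ-L = Finₚ.toℕ-fromℕ n

  toℕ-N : toℕ N ≡ suc k
  toℕ-N = trans (Finₚ.toℕ-inject₁ (fromℕ (suc k))) (Finₚ.toℕ-fromℕ (suc k))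

  ≤L : ∀ (a : Fin (suc n)) → a Fin.≤ L
  ≤L a = Finₚ.≤fromℕ a

  N<L : N Fin.< L
  N<L = subst₂ ℕ._<_ (sym toℕ-N) (sym toℕ-L) ℕₚ.≤-refl

  <L⇒≤N : ∀ {a : Fin (suc n)} → a Fin.< L → a Fin.≤ N
  <L⇒≤N {a} a<L = subst (toℕ a ℕ.≤_) (sym toℕ-N) (ℕ.s≤s⁻¹ (subst (toℕ a ℕ.<_) toℕ-L a<L))

  N<⇒≡L : ∀ {a} → N Fin.< a → a ≡ L
  N<⇒≡L {a} N<a = Finₚ.≤-antisym (≤L a) (subst (ℕ._≤ toℕ a) (trans (cong suc toℕ-N) (sym toℕ-L)) N<a)

  record Step (x z : Element) : Set where
    field
      u v     : Fin (suc n)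
      u<v     : u Fin.< v
      v-min   : IsMin x v
      isMerge : IsMerge x u v z
      -- Merging the singleton {L} into the block of N is the step with label n.
      avoidsN : ¬ (v ≡ L × u ~[ x ] N)

    u≁v : ¬ u ~[ x ] v
    u≁v u~v = ℕₚ.<⇒≱ u<v (v-min u (symmetric x u~v))

    covers : x ⋖ z
    covers = merge-covers isMerge u≁v

    private
      largest-below : ∃ λ l → (u ~[ x ] l × l Fin.< v) × (∀ {y} → u ~[ x ] y × y Fin.< v → y Fin.≤ l)
      largest-below = greatest (λ b → (u ~[ x ]? b) ×-dec (b Finₚ.<? v)) (u , reflexive x , u<v)

      l   = proj₁ largest-below
      u~l = proj₁ (proj₁ (proj₂ largest-below))
      l<v = proj₂ (proj₁ (proj₂ largest-below))
      ≤l  = proj₂ (proj₂ largest-below)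

    label : ℕ
    label = ⟦ l ⟧

    -- Since `⟦ l ⟧` is the successor of `toℕ l`, this is `l<v` verbatim. The bound is `toℕ v`, one
    -- less than `⟦ v ⟧`, which is what the parking count needs.
    label≤v : label ℕ.≤ toℕ v
    label≤v = l<v

    -- With label n the element `l` would be `N`, and only `L` is left for the larger `v`; this is
    -- the merge that `avoidsN` forbids.
    label≢n : label ≢ n
    label≢n eq = avoidsN (N<⇒≡L (subst (Fin._< v) l≡N l<v) , subst (u ~[ x ]_) l≡N u~l)
      where
      l≡N : l ≡ N
      l≡N = Finₚ.toℕ-injective (trans (ℕₚ.suc-injective eq) (sym toℕ-N))

    -- As `v` is the minimum of its block and `u` is smaller, the block of `u` contains the minimum
    -- of the union, and lying below the whole second block amounts to lying below `v`.
    isLabel : IsLabel x z label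
    isLabel = record
      { B₁-block   = u , refl
      ; B₂-block   = v , refl
      ; B₁≢B₂      = λ eq → u≁v (subst (v ∈_) (sym eq) (reflexive x))
      ; merged     = u , block-∪ isMerge
      ; min∈B₁     = minimum
      ; largest    = l
      ; largest∈B₁ = u~l
      ; largest<B₂ = λ y v~y → ℕₚ.<-≤-trans l<v (v-min y v~y)
      ; isLargest  = λ y u~y y< → ≤l (u~y , y< v (reflexive x))
      ; label      = refl
      }
      where
      minimum : ∃ λ w → u ~[ x ] w × (∀ y → y ∈ block (partition x) u ∪ block (partition x) v → w Fin.≤ y)
      minimum with w , w~u , w-min ← block-min x u =
        w , symmetric x w~u , λ y y∈ → above (x∈p∪q⁻ (block (partition x) u) _ y∈)
        where
        above : ∀ {y} → InMerged x u v y → w Fin.≤ y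
        above {y} (inj₁ u~y) = w-min y (transitive x w~u u~y)
        above {y} (inj₂ v~y) = ℕₚ.≤-trans (w-min u w~u) (ℕₚ.<⇒≤ (ℕₚ.<-≤-trans u<v (v-min y v~y)))

    v-not-min : ¬ IsMin z v
    v-not-min min = ℕₚ.<⇒≱ u<v (min u (symmetric z (joined isMerge)))

    min⁻ : ∀ {a} → IsMin z a → IsMin x a
    min⁻ min b a~b = min b (coarser isMerge _ a~b)

    min⁺ : ∀ {a} → IsMin x a → a ≢ v → IsMin z a
    min⁺ {a} min a≢v b a~b with merge⁻ isMerge a~b
    ... | inj₁ a~b = min b a~b
    ... | inj₂ (inj₂ v~a , _) = contradiction (Finₚ.≤-antisym (min v (symmetric x v~a)) (v-min a v~a)) a≢v
    ... | inj₂ (inj₁ u~a , inj₁ u~b) = min b (transitive x (symmetric x u~a) u~b)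
    ... | inj₂ (inj₁ u~a , inj₂ v~b) =
      ℕₚ.≤-trans (min u (symmetric x u~a)) (ℕₚ.<⇒≤ (ℕₚ.<-≤-trans u<v (v-min b v~b)))

  Path : Rel Element 0ℓ
  Path = Star Step

  steps : ∀ {x y} → Path x y → ℕ
  steps ε       = 0
  steps (_ ◅ p) = suc (steps p)

  node : ∀ {x y} (p : Path x y) → Fin (suc (steps p)) → Element
  node {x} p       zero    = x
  node     (_ ◅ p) (suc i) = node p i

  node-last : ∀ {x y} (p : Path x y) → node p (fromℕ (steps p)) ≡ y
  node-last ε       = refl
  node-last (_ ◅ p) = node-last p

  labels : ∀ {x y} (p : Path x y) → Vec ℕ (steps p)
  labels ε       = []
  labels (s ◅ p) = Step.label s ∷ labels p

  node-step : ∀ {x y} (p : Path x y) i →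
              Σ (Step (node p (inject₁ i)) (node p (suc i))) λ s → lookup (labels p) i ≡ Step.label s
  node-step (s ◅ p) zero    = s , refl
  node-step (s ◅ p) (suc i) = node-step p i

  node-◅◅ : ∀ {x y z} (p : Path x y) (q : Path y z) → ∃ λ i → y ≡ node (p ◅◅ q) i
  node-◅◅ ε       q = zero , refl
  node-◅◅ (s ◅ p) q with i , eq ← node-◅◅ p q = suc i , eq

  step-◅◅ : ∀ {w x y z} (p : Path w x) (s : Step x y) (q : Path y z) →
            ∃ λ i → x ≡ node (p ◅◅ s ◅ q) (inject₁ i) × y ≡ node (p ◅◅ s ◅ q) (suc i)
  step-◅◅ ε       s q = zero , refl , refl
  step-◅◅ (_ ◅ p) s q with i , eq , eq′ ← step-◅◅ p s q = suc i , eq , eq′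

  MinBelow : ℕ → Element → Pred (Fin (suc n)) 0ℓ
  MinBelow t x a = IsMin x a × toℕ a ℕ.< t

  minBelow? : ∀ t x → Decidable (MinBelow t x)
  minBelow? t x a = isMin? x a ×-dec below? t a

  mins-below : ℕ → Element → ℕ
  mins-below t x = count (minBelow? t x)

  mins-below-step : ∀ {x z} (s : Step x z) {t} → toℕ (Step.v s) ℕ.< t → mins-below t x ≡ suc (mins-below t z)
  mins-below-step {x} {z} s {t} v<t = count-remove (minBelow? t x) (minBelow? t z) {v} (v-min , v<t) (v-not-min ∘ proj₁)
    (λ (min , a<t) a≢v → min⁺ min a≢v , a<t) (λ (min , a<t) → min⁻ min , a<t)
    where open Step s

  mins-below-step′ : ∀ {x z} (s : Step x z) {t} → ¬ toℕ (Step.v s) ℕ.< t → mins-below t x ≡ mins-below t z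
  mins-below-step′ {x} {z} s {t} v≮t = count-cong (minBelow? t x) (minBelow? t z)
    (λ (min , a<t) → min⁺ min (λ a≡v → v≮t (subst (λ a → toℕ a ℕ.< t) a≡v a<t)) , a<t)
    (λ (min , a<t) → min⁻ min , a<t)
    where open Step s

  -- Each step destroys exactly one block minimum, so the length of a path is the drop in the number
  -- of blocks.
  steps-mins : ∀ {x y} (p : Path x y) → mins-below (suc n) x ≡ steps p ℕ.+ mins-below (suc n) y
  steps-mins ε       = refl
  steps-mins (s ◅ p) = trans (mins-below-step s (Finₚ.toℕ<n (Step.v s))) (cong suc (steps-mins p))

  -- A step destroys the block minimum v, and its label is at most toℕ v; hence the
  -- number of small labels is at least the number of small minima destroyed.
  small-labels : ∀ {x y} (p : Path x y) t →
                 mins-below (suc t) x ℕ.≤ length (filter (ℕₚ._≤? t) (toList (labels p))) ℕ.+ mins-below (suc t) y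
  small-labels ε       t = ℕₚ.≤-refl
  small-labels {x} {y} (_◅_ {j = z} s p) t with toℕ (Step.v s) ℕₚ.<? suc t | Step.label s ℕₚ.≤? t
  ... | yes v<1+t | no  l≰t = contradiction (ℕₚ.≤-trans (Step.label≤v s) (ℕ.s≤s⁻¹ v<1+t)) l≰t
  ... | yes v<1+t | yes l≤t = begin
    mins-below (suc t) x                                        ≡⟨ mins-below-step s v<1+t ⟩
    suc (mins-below (suc t) z)                                  ≤⟨ s≤s (small-labels p t) ⟩
    length (Step.label s ∷ small p) ℕ.+ mins-below (suc t) y
      ≡⟨ cong (λ l → length l ℕ.+ mins-below (suc t) y) (Listₚ.filter-accept (ℕₚ._≤? t) l≤t) ⟨
    length (small (s ◅ p)) ℕ.+ mins-below (suc t) y             ∎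
    where
    open ℕₚ.≤-Reasoning
    small : ∀ {x y} → Path x y → List ℕ
    small p = filter (ℕₚ._≤? t) (toList (labels p))
  ... | no  v≮1+t | _       = begin
    mins-below (suc t) x                              ≡⟨ mins-below-step′ s v≮1+t ⟩
    mins-below (suc t) z                              ≤⟨ small-labels p t ⟩
    length (small p) ℕ.+ mins-below (suc t) y         ≤⟨ ℕₚ.+-monoˡ-≤ _ longer ⟩
    length (small (s ◅ p)) ℕ.+ mins-below (suc t) y   ∎
    where
    open ℕₚ.≤-Reasoning
    small : ∀ {x y} → Path x y → List ℕ
    small p = filter (ℕₚ._≤? t) (toList (labels p))
    longer : length (small p) ℕ.≤ length (small (s ◅ p))
    longer with Step.label s ℕₚ.≤? t
    ... | yes l≤t = ℕₚ.≤-trans (ℕₚ.n≤1+n _) (ℕₚ.≤-reflexive (cong length (sym (Listₚ.filter-accept (ℕₚ._≤? t) l≤t))))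
    ... | no  l≰t = ℕₚ.≤-reflexive (cong length (sym (Listₚ.filter-reject (ℕₚ._≤? t) l≰t)))

-- The order of Poset(PF_{n,n})

module PFOrder (k : ℕ) where
  open Chains k
  <L-or-≡L : ∀ a → a Fin.< L ⊎ a ≡ L
  <L-or-≡L a with a Finₚ.≟ L
  ... | yes a≡L = inj₂ a≡L
  ... | no  a≢L = inj₁ (Finₚ.≤∧≢⇒< (≤L a) a≢L)

  -- If L joins the block of N on the way from x to y, then L can first be merged
  -- with a block that avoids N exactly when the block of N in y reaches below the
  -- block of N in x.
  Good : Rel Element 0ℓ
  Good x y = N ~[ y ] L → ¬ N ~[ x ] L → ∃ λ b → b ~[ y ] N × (∀ {c} → c ~[ x ] N → b Fin.< c)

  -- The witness comes from the stage at which `N` and `L` get joined. If that is after `y`, the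
  -- block of `N` has only grown since `x`, so an element below it in `y` is below it in `x` as
  -- well.
  good-trans : ∀ {x y w} → x ≤ᴺ y → y ≤ᴺ w → Good x y → Good y w → Good x w
  good-trans {x} {y} {w} x≤y y≤w xy yw N~L N≁L with N ~[ y ]? L
  ... | yes N~ʸL with b , b~N , b< ← xy N~ʸL N≁L = b , y≤w b b~N , b<
  ... | no  N≁ʸL with b , b~N , b< ← yw N~L N≁ʸL = b , b~N , λ {c} c~N → b< (x≤y c c~N)

  abstract
    -- The companion `b` of `L` is the witness: an element `c` of the block of `N` below `b` would
    -- make the chords from `c` to `N` and from `b` to `L` cross. Hence `Good` restricts anything
    -- only while `L` is a singleton.
    nonsingleton-good : ∀ {x y} → x ≤ᴺ y → ∀ {b} → b ~[ x ] L → b Fin.< L → Good x y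
    nonsingleton-good {x} {y} x≤y {b} b~L b<L N~L N≁L =
      b , transitive y (x≤y b b~L) (symmetric y N~L) , below
      where
      b<N : b Fin.< N
      b<N = Finₚ.≤∧≢⇒< (<L⇒≤N b<L) (λ { refl → N≁L b~L })
      below : ∀ {c} → c ~[ x ] N → b Fin.< c
      below {c} c~N with Finₚ.<-cmp b c
      ... | tri< b<c _ _ = b<c
      ... | tri≈ _ refl _ = contradiction (transitive x (symmetric x c~N) b~L) N≁L
      ... | tri> _ _ c<b = contradiction
        (transitive x (symmetric x c~N) (transitive x (uncrossed x c<b b<N N<L c~N b~L) b~L)) N≁L

  Advance : Rel Element 0ℓ
  Advance x y = ∃ λ z → Step x z × z ≤ᴺ y × Good z y

  -- Two blocks of `x` inside one block of `y` have different minima, of which only one can survive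
  -- in `y`. So a proper coarsening always exposes a lost minimum at which to make the next merge.
  minimal⇒≡ : ∀ {x y : Element} → x ≤ᴺ y → (∀ {v} → IsMin x v → IsMin y v) → x ≡ y
  minimal⇒≡ {x} {y} x≤y min⇒ = ≤ᴺ-antisym x≤y y≤x
    where
    y≤x : y ≤ᴺ x
    y≤x a {b} a~b with block-min x a | block-min x b
    ... | l , l~a , l-min | l′ , l′~b , l′-min =
      transitive x (symmetric x l~a) (subst (_~[ x ] b) (sym l≡l′) l′~b)
      where
      l~l′ : l ~[ y ] l′
      l~l′ = transitive y (x≤y l l~a) (transitive y a~b (symmetric y (x≤y l′ l′~b)))
      l≡l′ : l ≡ l′
      l≡l′ = Finₚ.≤-antisym (min⇒ l-min l′ l~l′) (min⇒ l′-min l (symmetric y l~l′))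

  -- L is a singleton of x that has to join the block of N: merge it with the block
  -- of the least element u of that block of y, which does not contain N.
  advance-L : ∀ {x y} → x ≤ᴺ y → Good x y → N ~[ y ] L → IsMin x L → Advance x y
  advance-L {x} {y} x≤y good N~L L-min
    with good N~L (λ N~L → ℕₚ.<⇒≱ N<L (L-min N (symmetric x N~L))) | block-min y N
  ... | b , b~N , b< | u , u~N , u-min = z , step , z≤y , nonsingleton-good {z} {y} z≤y (joined isMerge) u<L
    where
    u≤b : u Fin.≤ b
    u≤b = u-min b (transitive y u~N (symmetric y b~N))
    u<L : u Fin.< L
    u<L = ℕₚ.≤-<-trans u≤b (ℕₚ.<-trans (b< (reflexive x)) N<L)
    merge = ∃-merge x u L {y} x≤y (transitive y u~N N~L) λ {w} {w′} _ u~w _ _ →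
      (λ w<u _ → contradiction (u-min w u~w) (ℕₚ.<⇒≱ w<u)) ,
      (λ _ L<w′ → contradiction (≤L w′) (ℕₚ.<⇒≱ L<w′))
    z       = proj₁ merge
    isMerge = proj₁ (proj₂ merge)
    z≤y     = proj₂ (proj₂ merge)
    step : Step x z
    step = record
      { u = u ; v = L ; u<v = u<L ; v-min = L-min ; isMerge = isMerge
      ; avoidsN = λ (_ , u~N) → ℕₚ.<⇒≱ (b< u~N) u≤b }

  -- Merging v with its predecessor u in the block of y creates no crossing, since
  -- no element of that block lies between u and v.
  advance-other : ∀ {x y} → x ≤ᴺ y → ¬ (N ~[ y ] L × IsMin x L) →
                  ∀ {v} → IsMin x v → ¬ IsMin y v → Advance x y
  advance-other {x} {y} x≤y other {v} v-min ¬v-min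
    with greatest (λ b → (b ~[ y ]? v) ×-dec (b Finₚ.<? v)) (¬isMin⇒ y ¬v-min)
  ... | u , (u~v , u<v) , ≤u = z , step , z≤y , good
    where
    adjacent : ∀ {w} → u ~[ y ] w → ¬ v ~[ x ] w → u Fin.< w → v Fin.< w
    adjacent {w} u~w v≁w u<w with Finₚ.<-cmp v w
    ... | tri< v<w _ _ = v<w
    ... | tri≈ _ refl _ = contradiction (reflexive x) v≁w
    ... | tri> _ _ w<v = contradiction (≤u (transitive y (symmetric y u~w) u~v , w<v)) (ℕₚ.<⇒≱ u<w)
    below : ∀ {w} → u ~[ y ] w → ¬ u ~[ x ] w → w Fin.< v → w Fin.< u
    below {w} u~w u≁w w<v = Finₚ.≤∧≢⇒< (≤u (transitive y (symmetric y u~w) u~v , w<v)) (λ { refl → u≁w (reflexive x) })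
    merge = ∃-merge x u v {y} x≤y u~v λ {w} {w′} w~w′ u~w u≁w v≁w →
      (λ w<u u<w′ → ℕₚ.<-trans w<u u<v ,
        adjacent (transitive y u~w (x≤y w w~w′)) (λ v~w′ → v≁w (transitive x v~w′ (symmetric x w~w′))) u<w′) ,
      (λ w<v v<w′ → below u~w u≁w w<v , ℕₚ.<-trans u<v v<w′)
    z       = proj₁ merge
    isMerge = proj₁ (proj₂ merge)
    z≤y     = proj₂ (proj₂ merge)
    step : Step x z
    step = record
      { u = u ; v = v ; u<v = u<v ; v-min = v-min ; isMerge = isMerge
      ; avoidsN = λ { (refl , u~N) → other (transitive y (symmetric y (x≤y u u~N)) u~v , v-min) } }
    good : Good z y
    good N~L with isMin? x L
    ... | yes L-min = contradiction (N~L , L-min) other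
    ... | no ¬L-min with b , b~L , b<L ← ¬isMin⇒ x ¬L-min =
      nonsingleton-good {z} {y} z≤y (coarser isMerge b b~L) b<L N~L

  -- A singleton `L` bound for the block of `N` is attached immediately, before that block can grow
  -- down to the least element of its final block. Otherwise any lost minimum will do, since `N` and
  -- `L` stay apart in `y` or `L` already has a companion, and `Good` persists.
  advance : ∀ {x y} → x ≤ᴺ y → Good x y → x ≡ y ⊎ Advance x y
  advance {x} {y} x≤y good with (N ~[ y ]? L) ×-dec isMin? x L
  ... | yes (N~L , L-min) = inj₂ (advance-L {x} {y} x≤y good N~L L-min)
  ... | no other with Finₚ.any? (λ v → isMin? x v ×-dec ¬? (isMin? y v))
  ...   | yes (v , v-min , ¬v-min) = inj₂ (advance-other {x} {y} x≤y other v-min ¬v-min)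
  ...   | no none = inj₁ (minimal⇒≡ {x} {y} x≤y λ {v} v-min → decidable-stable (isMin? y v) (λ ¬min → none (v , v-min , ¬min)))

  good-path : ∀ {x y} → x ≤ᴺ y → Good x y → Path x y
  good-path {x} {y} x≤y good = go {x} (mins-below (suc n) x) ℕₚ.≤-refl x≤y good
    where
    go : ∀ {x} j → mins-below (suc n) x ℕ.≤ j → x ≤ᴺ y → Good x y → Path x y
    go {x} j mins≤j x≤y good with advance {x} {y} x≤y good
    ... | inj₁ refl = ε
    go {x} j mins≤j x≤y good | inj₂ (z , step , z≤y , z-good)
      with subst (ℕ._≤ j) (mins-below-step step (Finₚ.toℕ<n (Step.v step))) mins≤j
    go {x} (suc j) mins≤j x≤y good | inj₂ (z , step , z≤y , z-good) | s≤s mins≤j′ =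
      step ◅ go {z} j mins≤j′ z≤y z-good

  abstract
    ⊥ᴺ : Element
    ⊥ᴺ = toNC (fromRelation Finₚ._≟_ isEquivalence) λ {a} {b} {c} a<b b<c _ a~c _ →
      contradiction (fromRelation⁻ Finₚ._≟_ isEquivalence a~c) (Finₚ.<⇒≢ (ℕₚ.<-trans a<b b<c))

    ⊥ᴺ-≡ : ∀ {a b} → a ~[ ⊥ᴺ ] b → a ≡ b
    ⊥ᴺ-≡ = fromRelation⁻ Finₚ._≟_ isEquivalence

    ⊤ᴺ : Element
    ⊤ᴺ = toNC (fromRelation (λ _ _ → yes tt) _) λ {a} {b} _ _ _ _ _ → fromRelation⁺ (λ _ _ → yes tt) _ {a} {b} tt

    ⊤ᴺ-~ : ∀ {a b} → a ~[ ⊤ᴺ ] b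
    ⊤ᴺ-~ {a} {b} = fromRelation⁺ (λ _ _ → yes tt) _ {a} {b} tt

  ⊥ᴺ-minimum : ∀ x → ⊥ᴺ ≤ᴺ x
  ⊥ᴺ-minimum x a a~b = subst (a ~[ x ]_) (⊥ᴺ-≡ a~b) (reflexive x)

  ⊤ᴺ-maximum : ∀ x → x ≤ᴺ ⊤ᴺ
  ⊤ᴺ-maximum x a _ = ⊤ᴺ-~

  mins-below-⊥ᴺ : ∀ {t} → t ℕ.≤ suc n → mins-below t ⊥ᴺ ≡ t
  mins-below-⊥ᴺ {t} t≤ = trans
    (count-cong (minBelow? t ⊥ᴺ) (below? t) proj₂ (λ a<t → (λ b a~b → ℕₚ.≤-reflexive (cong toℕ (⊥ᴺ-≡ a~b))) , a<t))
    (count-below t t≤)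

  mins-below-⊤ᴺ : ∀ {t} → 0 ℕ.< t → mins-below t ⊤ᴺ ≡ 1
  mins-below-⊤ᴺ {t} 0<t = trans
    (count-cong (minBelow? t ⊤ᴺ) (below? 1) (λ {a} (min , _) → s≤s (min zero ⊤ᴺ-~))
      (λ {a} a<1 → (λ b _ → ℕₚ.≤-trans (ℕ.s≤s⁻¹ a<1) z≤n) , ℕₚ.≤-<-trans (ℕ.s≤s⁻¹ a<1) 0<t))
    (count-below {suc n} 1 (s≤s z≤n))

  -- The length is a variable because the length of a path equals `n` only by a proved equation;
  -- matching on that equation makes a `PFChain` of it.
  record LabelledChain (j : ℕ) : Set where
    field
      vertex  : Fin (suc j) → Element
      c-labels : Vec ℕ j
      first   : vertex zero ≡ ⊥ᴺ
      last    : vertex (fromℕ j) ≡ ⊤ᴺ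
      step    : ∀ i → Σ (Step (vertex (inject₁ i)) (vertex (suc i))) λ s → lookup c-labels i ≡ Step.label s
      parking : IsParking c-labels

  toPFChain : LabelledChain n → PFChain n
  toPFChain c = record
    { chain     = record
      { element = vertex
      ; bottom  = λ x → subst (_≤ᴺ x) (sym first) (⊥ᴺ-minimum x)
      ; top     = λ x → subst (x ≤ᴺ_) (sym last) (⊤ᴺ-maximum x)
      ; covers  = λ i → Step.covers (proj₁ (step i))
      }
    ; labels    = c-labels
    ; hasLabels = λ i → subst (IsLabel _ _) (sym (proj₂ (step i))) (Step.isLabel (proj₁ (step i)))
    ; parking   = parking , λ i → subst (_≢ n) (sym (proj₂ (step i))) (Step.label≢n (proj₁ (step i)))
    }
    where open LabelledChain c

  steps-⊥⊤ : (p : Path ⊥ᴺ ⊤ᴺ) → steps p ≡ n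
  steps-⊥⊤ p = ℕₚ.suc-injective (begin
    suc (steps p)                         ≡⟨ ℕₚ.+-comm 1 (steps p) ⟩
    steps p ℕ.+ 1                         ≡⟨ cong (steps p ℕ.+_) (mins-below-⊤ᴺ (s≤s z≤n)) ⟨
    steps p ℕ.+ mins-below (suc n) ⊤ᴺ     ≡⟨ steps-mins p ⟨
    mins-below (suc n) ⊥ᴺ                 ≡⟨ mins-below-⊥ᴺ ℕₚ.≤-refl ⟩
    suc n                                 ∎)
    where open ≡-Reasoning

  path-chain : (p : Path ⊥ᴺ ⊤ᴺ) → LabelledChain (steps p)
  path-chain p = record
    { vertex    = node p
    ; c-labels  = labels p
    ; first     = refl
    ; last      = node-last p
    ; step      = node-step p
    ; parking   = isParking (labels p)
      (λ i → subst (1 ℕ.≤_) (sym (proj₂ (node-step p i))) (s≤s z≤n))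
      (λ t t≤ → ℕ.s≤s⁻¹ (enough t (s≤s (subst (t ℕ.≤_) (steps-⊥⊤ p) t≤))))
    }
    where
    open ℕₚ.≤-Reasoning
    small : ℕ → ℕ
    small t = length (filter (ℕₚ._≤? t) (toList (labels p)))
    -- Of the t + 1 elements with `toℕ` at most `t`, all are minima at the bottom and one is at the
    -- top; the `t` minima destroyed in between account for `t` small labels.
    enough : ∀ t → t ℕ.< suc n → suc t ℕ.≤ suc (small t)
    enough t t<1+n = begin
      suc t                              ≡⟨ mins-below-⊥ᴺ t<1+n ⟨
      mins-below (suc t) ⊥ᴺ              ≤⟨ small-labels p t ⟩
      small t ℕ.+ mins-below (suc t) ⊤ᴺ  ≡⟨ cong (small t ℕ.+_) (mins-below-⊤ᴺ (s≤s z≤n)) ⟩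
      small t ℕ.+ 1                      ≡⟨ ℕₚ.+-comm (small t) 1 ⟩
      suc (small t)                      ∎

  module _ {j} (c : LabelledChain j) where
    open LabelledChain c

    chain-element : j ≡ n → ∀ i → OnPFChain n (vertex i)
    chain-element refl i = toPFChain c , i , refl

    chain-cover : j ≡ n → ∀ i → PFCover n (vertex (inject₁ i)) (vertex (suc i))
    chain-cover refl i = toPFChain c , i , refl , refl

  Allowed : Pred Element 0ℓ
  Allowed x = Good ⊥ᴺ x × Good x ⊤ᴺ

  abstract
    allowed⇒onPFChain : ∀ {x} → Allowed x → OnPFChain n x
    allowed⇒onPFChain {x} (from-⊥ , to-⊤) = let (i , x≡) = node-◅◅ p q in
      subst (OnPFChain n) (sym x≡) (chain-element (path-chain (p ◅◅ q)) (steps-⊥⊤ (p ◅◅ q)) i)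
      where
      p : Path ⊥ᴺ x
      p = good-path {⊥ᴺ} {x} (⊥ᴺ-minimum x) from-⊥
      q : Path x ⊤ᴺ
      q = good-path {x} {⊤ᴺ} (⊤ᴺ-maximum x) to-⊤

  -- A step is a `PFCover` only as part of a maximal chain, so the path below and the path above are
  -- carried along to complete each step to one.
  path⇒PFCover* : ∀ {x y} → Path ⊥ᴺ x → Path x y → Path y ⊤ᴺ → Star (PFCover n) x y
  path⇒PFCover* p ε       q = ε
  path⇒PFCover* p (s ◅ r) q = let (i , x≡ , z≡) = step-◅◅ p s (r ◅◅ q) in
    subst₂ (PFCover n) (sym x≡) (sym z≡) (chain-cover (path-chain _) (steps-⊥⊤ (p ◅◅ s ◅ r ◅◅ q)) i) ◅
    path⇒PFCover* (p ◅◅ s ◅ ε) r q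

  good⇒PFCover* : ∀ {x y} → Allowed x → Allowed y → x ≤ᴺ y → Good x y → Star (PFCover n) x y
  good⇒PFCover* {x} {y} (⊥-x , _) (_ , y-⊤) x≤y good =
    path⇒PFCover* (good-path {⊥ᴺ} {x} (⊥ᴺ-minimum x) ⊥-x) (good-path {x} {y} x≤y good)
      (good-path {y} {⊤ᴺ} (⊤ᴺ-maximum y) y-⊤)

  -- If `L` is a singleton that the cover joins to `N`, then the merged blocks are {L} and the block
  -- of `N`. The minimum of the union is at most `N`, so the latter is `B₁`; its largest element
  -- below `L` is `N`, which gives the excluded label n.
  labelled-cover-good : ∀ {x z t} → x ⋖ z → IsLabel x z t → t ≢ n → Good x z
  labelled-cover-good {x} {z} {t} cover isLabel t≢n N~L N≁L = by-cases (isMin? x L)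
    where
    open IsLabel isLabel
    module Singleton (L-min : IsMin x L) {u v} (B₁≡ : B₁ ≡ block (partition x) u) (B₂≡ : B₂ ≡ block (partition x) v) where
      ∈B₁ : ∀ {a} → u ~[ x ] a → a ∈ B₁
      ∈B₁ {a} = subst (a ∈_) (sym B₁≡)
      ∈B₂ : ∀ {a} → v ~[ x ] a → a ∈ B₂
      ∈B₂ {a} = subst (a ∈_) (sym B₂≡)
      L-singleton : ∀ {a} → L ~[ x ] a → a ≡ L
      L-singleton {a} L~a = Finₚ.≤-antisym (≤L a) (L-min a L~a)
      cases : Merged x u v N L → ⊥
      cases (inj₁ N~L) = N≁L N~L
      cases (inj₂ (inj₁ u~N , inj₁ u~L)) = N≁L (transitive x (symmetric x u~N) u~L)
      cases (inj₂ (inj₂ v~N , inj₂ v~L)) = N≁L (transitive x (symmetric x v~N) v~L)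
      cases (inj₂ (inj₂ v~N , inj₁ u~L)) with w , w∈B₁ , w≤ ← min∈B₁ =
        ℕₚ.<⇒≱ N<L (subst (Fin._≤ N) (L-singleton (transitive x (symmetric x u~L) (subst (w ∈_) B₁≡ w∈B₁)))
          (w≤ N (x∈p∪q⁺ (inj₂ (∈B₂ v~N)))))
      cases (inj₂ (inj₁ u~N , inj₂ v~L)) = t≢n (trans label (cong suc (trans (cong toℕ largest≡N) toℕ-N)))
        where
        N<B₂ : ∀ y → y ∈ B₂ → N Fin.< y
        N<B₂ y y∈B₂ = subst (N Fin.<_) (sym (L-singleton (transitive x (symmetric x v~L) (subst (y ∈_) B₂≡ y∈B₂)))) N<L
        largest≡N : largest ≡ N
        largest≡N = Finₚ.≤-antisym (<L⇒≤N (largest<B₂ L (∈B₂ v~L))) (isLargest N (∈B₁ u~N) N<B₂)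
    by-cases : Dec (IsMin x L) → ∃ λ b → b ~[ z ] N × (∀ {c} → c ~[ x ] N → b Fin.< c)
    by-cases (no ¬L-min) = let (b , b~L , b<L) = ¬isMin⇒ x ¬L-min in
      nonsingleton-good {x} {z} (proj₁ cover) b~L b<L N~L N≁L
    by-cases (yes L-min) = let (u , v , B₁≡ , B₂≡ , isMerge) = labelled-merge cover isLabel in
      ⊥-elim (Singleton.cases L-min B₁≡ B₂≡ (merge⁻ isMerge N~L))

  PFCover*⇒good : ∀ {x y} → Star (PFCover n) x y → Good x y
  PFCover*⇒good ε N~L N≁L = contradiction N~L N≁L
  PFCover*⇒good {y = y} (_◅_ {i = x} {j = z} (c , i , refl , refl) p) =
    good-trans {x} {z} {y} (proj₁ cover) (PFCover*⇒≤ᴺ p)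
      (labelled-cover-good cover (PFChain.hasLabels c i) (proj₂ (PFChain.parking c) i)) (PFCover*⇒good p)
    where
    cover : x ⋖ z
    cover = MaximalChain.covers (chain c) i

  chain-path : ∀ {j} (e : Fin (suc j) → Element) → (∀ i → PFCover n (e (inject₁ i)) (e (suc i))) →
               ∀ i → Star (PFCover n) (e zero) (e i) × Star (PFCover n) (e i) (e (fromℕ j))
  chain-path {zero}  e covers zero = ε , ε
  chain-path {suc j} e covers zero = ε , covers zero ◅ proj₂ (chain-path (e ∘ suc) (covers ∘ suc) zero)
  chain-path {suc j} e covers (suc i) with up , down ← chain-path (e ∘ suc) (covers ∘ suc) i =
    covers zero ◅ up , down

  onPFChain⇒allowed : ∀ {x} → OnPFChain n x → Allowed x
  onPFChain⇒allowed (c , i , refl) with chain-path (element (chain c)) (λ i → c , i , refl , refl) i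
  ... | up , down =
    subst (λ b → Good b x) (≤ᴺ-antisym {σ = b} {⊥ᴺ} (bottom ⊥ᴺ) (⊥ᴺ-minimum b)) (PFCover*⇒good up) ,
    subst (Good x) (≤ᴺ-antisym {σ = t} {⊤ᴺ} (⊤ᴺ-maximum t) (top ⊤ᴺ)) (PFCover*⇒good down)
    where
    open MaximalChain (chain c) using (bottom; top)
    x b t : Element
    x = element (chain c) i
    b = element (chain c) zero
    t = element (chain c) (fromℕ n)

-- Pairs, triples and two-block partitions

module Shapes (k : ℕ) where
  open Chains k
  open PFOrder k
  module Single {P : Pred (Fin (suc n)) 0ℓ} (P? : Decidable P) where
    private
      R : Rel (Fin (suc n)) 0ℓ
      R a b = a ≡ b ⊎ P a × P b

      R? : Decidable₂ R
      R? a b = (a Finₚ.≟ b) ⊎-dec (P? a ×-dec P? b)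

      R-equivalence : IsEquivalence R
      R-equivalence = record
        { refl  = inj₁ refl
        ; sym   = λ { (inj₁ refl) → inj₁ refl ; (inj₂ (pa , pb)) → inj₂ (pb , pa) }
        ; trans = λ { (inj₁ refl) bc → bc ; ab (inj₁ refl) → ab ; (inj₂ (pa , _)) (inj₂ (_ , pc)) → inj₂ (pa , pc) }
        }

    abstract
      single : Element
      single = toNC (fromRelation R? R-equivalence) λ {a} {b} {c} {d} a<b b<c c<d a~c b~d →
        fromRelation⁺ R? R-equivalence (cases a<b b<c c<d (fromRelation⁻ R? R-equivalence a~c) (fromRelation⁻ R? R-equivalence b~d))
        where
        cases : ∀ {a b c d} → a Fin.< b → b Fin.< c → c Fin.< d → R a c → R b d → R a b
        cases a<b b<c c<d (inj₁ refl) _ = contradiction b<c (ℕₚ.<-asym a<b)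
        cases a<b b<c c<d _ (inj₁ refl) = contradiction c<d (ℕₚ.<-asym b<c)
        cases a<b b<c c<d (inj₂ (pa , _)) (inj₂ (pb , _)) = inj₂ (pa , pb)

      single⁺ : ∀ {a b} → P a → P b → a ~[ single ] b
      single⁺ pa pb = fromRelation⁺ R? R-equivalence (inj₂ (pa , pb))

      single⁻ : ∀ {a b} → a ~[ single ] b → a ≡ b ⊎ P a × P b
      single⁻ = fromRelation⁻ R? R-equivalence

  open Single using (single; single⁺; single⁻)

  single≤ : ∀ {P : Pred (Fin (suc n)) 0ℓ} (P? : Decidable P) {x} →
            (∀ {a b} → P a → P b → a ~[ x ] b) → single P? ≤ᴺ x
  single≤ P? {x} P~ a a~b with single⁻ P? a~b
  ... | inj₁ refl      = reflexive x
  ... | inj₂ (pa , pb) = P~ pa pb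

  module _ (i j : Fin (suc n)) where
    Pair : Pred (Fin (suc n)) 0ℓ
    Pair a = a ≡ i ⊎ a ≡ j

    abstract
      pair? : Decidable Pair
      pair? a = (a Finₚ.≟ i) ⊎-dec (a Finₚ.≟ j)

    pair : Element
    pair = single pair?

    pair-~ : i ~[ pair ] j
    pair-~ = single⁺ pair? (inj₁ refl) (inj₂ refl)

    pair≤ : ∀ {x} → i ~[ x ] j → pair ≤ᴺ x
    pair≤ {x} i~j = single≤ pair? {x} λ
      { (inj₁ refl) (inj₁ refl) → reflexive x
      ; (inj₁ refl) (inj₂ refl) → i~j
      ; (inj₂ refl) (inj₁ refl) → symmetric x i~j
      ; (inj₂ refl) (inj₂ refl) → reflexive x }

    pair-isolated : ∀ {a b} → a ≢ i → a ≢ j → b ~[ pair ] a → b ≡ a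
    pair-isolated a≢i a≢j b~a with single⁻ pair? b~a
    ... | inj₁ b≡a = b≡a
    ... | inj₂ (_ , inj₁ a≡i) = contradiction a≡i a≢i
    ... | inj₂ (_ , inj₂ a≡j) = contradiction a≡j a≢j

    pair-atom : ∀ {y a b} → y ≤ᴺ pair → a ≢ b → a ~[ y ] b → pair ≤ᴺ y
    pair-atom {y} {a} {b} y≤ a≢b a~b with single⁻ pair? (y≤ a a~b)
    ... | inj₁ a≡b = contradiction a≡b a≢b
    ... | inj₂ (inj₁ refl , inj₁ refl) = contradiction refl a≢b
    ... | inj₂ (inj₂ refl , inj₂ refl) = contradiction refl a≢b
    ... | inj₂ (inj₁ refl , inj₂ refl) = pair≤ {y} a~b
    ... | inj₂ (inj₂ refl , inj₁ refl) = pair≤ {y} (symmetric y a~b)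

  module _ (d : Fin (suc n)) where
    Triple : Pred (Fin (suc n)) 0ℓ
    Triple a = a ≡ d ⊎ a ≡ N ⊎ a ≡ L

    abstract
      triple? : Decidable Triple
      triple? a = (a Finₚ.≟ d) ⊎-dec ((a Finₚ.≟ N) ⊎-dec (a Finₚ.≟ L))

    triple : Element
    triple = single triple?

    triple≤ : ∀ {x} → d ~[ x ] N → N ~[ x ] L → triple ≤ᴺ x
    triple≤ {x} d~N N~L = single≤ triple? {x} λ pa pb → transitive x (symmetric x (N~ pa)) (N~ pb)
      where
      N~ : ∀ {a} → Triple a → N ~[ x ] a
      N~ (inj₁ refl)        = symmetric x d~N
      N~ (inj₂ (inj₁ refl)) = reflexive x
      N~ (inj₂ (inj₂ refl)) = N~L

    triple-d~N : d ~[ triple ] N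
    triple-d~N = single⁺ triple? (inj₁ refl) (inj₂ (inj₁ refl))

    triple-d~L : d ~[ triple ] L
    triple-d~L = single⁺ triple? (inj₁ refl) (inj₂ (inj₂ refl))

    triple-N~L : N ~[ triple ] L
    triple-N~L = single⁺ triple? (inj₂ (inj₁ refl)) (inj₂ (inj₂ refl))

    triple-below-N : ∀ {b} → b Fin.< N → b ~[ triple ] N → b ≡ d
    triple-below-N b<N b~N with single⁻ triple? b~N
    ... | inj₁ refl = contradiction refl (Finₚ.<⇒≢ b<N)
    ... | inj₂ (inj₁ b≡d , _) = b≡d
    ... | inj₂ (inj₂ (inj₁ refl) , _) = contradiction refl (Finₚ.<⇒≢ b<N)
    ... | inj₂ (inj₂ (inj₂ refl) , _) = contradiction b<N (ℕₚ.<-asym N<L)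

    below-triple : ∀ {y} → y ≤ᴺ triple → ¬ d ~[ y ] N → ¬ N ~[ y ] L → y ≤ᴺ pair d L
    below-triple {y} y≤ d≁N N≁L a {b} a~b with single⁻ triple? (y≤ a a~b)
    ... | inj₁ refl = reflexive (pair d L)
    ... | inj₂ (inj₁ refl        , inj₁ refl)        = reflexive (pair d L)
    ... | inj₂ (inj₁ refl        , inj₂ (inj₁ refl)) = contradiction a~b d≁N
    ... | inj₂ (inj₁ refl        , inj₂ (inj₂ refl)) = pair-~ d L
    ... | inj₂ (inj₂ (inj₁ refl) , inj₁ refl)        = contradiction (symmetric y a~b) d≁N
    ... | inj₂ (inj₂ (inj₁ refl) , inj₂ (inj₁ refl)) = reflexive (pair d L)
    ... | inj₂ (inj₂ (inj₁ refl) , inj₂ (inj₂ refl)) = contradiction a~b N≁L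
    ... | inj₂ (inj₂ (inj₂ refl) , inj₁ refl)        = symmetric (pair d L) (pair-~ d L)
    ... | inj₂ (inj₂ (inj₂ refl) , inj₂ (inj₁ refl)) = contradiction (symmetric y a~b) N≁L
    ... | inj₂ (inj₂ (inj₂ refl) , inj₂ (inj₂ refl)) = reflexive (pair d L)

  module _ (e : Fin (suc n)) where
    Inner : Pred (Fin (suc n)) 0ℓ
    Inner a = e Fin.< a × a Fin.< L

    inner? : Decidable Inner
    inner? a = (e Finₚ.<? a) ×-dec (a Finₚ.<? L)

    private
      R : Rel (Fin (suc n)) 0ℓ
      R a b = Inner a × Inner b ⊎ ¬ Inner a × ¬ Inner b

      R? : Decidable₂ R
      R? a b = (inner? a ×-dec inner? b) ⊎-dec (¬? (inner? a) ×-dec ¬? (inner? b))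

      R-refl : ∀ {a} → R a a
      R-refl {a} with inner? a
      ... | yes ia = inj₁ (ia , ia)
      ... | no ¬ia = inj₂ (¬ia , ¬ia)

      R-equivalence : IsEquivalence R
      R-equivalence = record
        { refl  = R-refl
        ; sym   = λ { (inj₁ (ia , ib)) → inj₁ (ib , ia) ; (inj₂ (oa , ob)) → inj₂ (ob , oa) }
        ; trans = λ { (inj₁ (ia , _)) (inj₁ (_ , ic)) → inj₁ (ia , ic)
                    ; (inj₁ (_ , ib)) (inj₂ (ob , _)) → contradiction ib ob
                    ; (inj₂ (_ , ob)) (inj₁ (ib , _)) → contradiction ib ob
                    ; (inj₂ (oa , _)) (inj₂ (_ , oc)) → inj₂ (oa , oc) }
        }

    abstract
      -- The blocks are {1, …, e, L} and {e + 1, …, N}.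
      cut : Element
      cut = toNC (fromRelation R? R-equivalence) λ {a} {b} {c} {d} a<b b<c c<d a~c b~d →
        fromRelation⁺ R? R-equivalence (cases a<b b<c c<d (fromRelation⁻ R? R-equivalence a~c) (fromRelation⁻ R? R-equivalence b~d))
        where
        cases : ∀ {a b c d} → a Fin.< b → b Fin.< c → c Fin.< d → R a c → R b d → R a b
        cases _ _ _ (inj₁ (ia , _)) (inj₁ (ib , _)) = inj₁ (ia , ib)
        cases _ _ _ (inj₂ (oa , _)) (inj₂ (ob , _)) = inj₂ (oa , ob)
        cases a<b b<c c<d (inj₁ ((e<a , _) , (_ , c<L))) (inj₂ (ob , _)) =
          contradiction (ℕₚ.<-trans e<a a<b , ℕₚ.<-trans b<c c<L) ob
        cases a<b b<c c<d (inj₂ (_ , oc)) (inj₁ ((e<b , _) , (_ , d<L))) =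
          contradiction (ℕₚ.<-trans e<b b<c , ℕₚ.<-trans c<d d<L) oc

      cut⁺ : ∀ {a b} → (Inner a → Inner b) → (Inner b → Inner a) → a ~[ cut ] b
      cut⁺ {a} {b} a⇒b b⇒a with inner? a
      ... | yes ia = fromRelation⁺ R? R-equivalence (inj₁ (ia , a⇒b ia))
      ... | no  oa = fromRelation⁺ R? R-equivalence (inj₂ (oa , oa ∘ b⇒a))

      cut⁻ : ∀ {a b} → a ~[ cut ] b → Inner a → Inner b
      cut⁻ a~b ia with fromRelation⁻ R? R-equivalence a~b
      ... | inj₁ (_ , ib) = ib
      ... | inj₂ (oa , _) = contradiction ia oa

    cut-N≁L : e Fin.< N → ¬ N ~[ cut ] L
    cut-N≁L e<N N~L = ℕₚ.<-irrefl refl (proj₂ (cut⁻ N~L (e<N , N<L)))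

  0<N : zero {suc (suc k)} Fin.< N
  0<N = subst (0 ℕ.<_) (sym toℕ-N) (s≤s z≤n)

  abstract
    -- Towards the top the witness is `zero`: it lies below the whole block of `N` as soon as it
    -- lies outside it.
    apart-allowed : ∀ {x} → ¬ N ~[ x ] L → ¬ zero ~[ x ] N → Allowed x
    apart-allowed {x} N≁L 0≁N = (λ N~L _ → contradiction N~L N≁L) ,
      λ _ _ → zero , ⊤ᴺ-~ , λ { {zero} 0~N → contradiction 0~N 0≁N ; {suc c} _ → s≤s z≤n }

  abstract
    -- Refining shrinks the block of `N`, so a witness below this block in `x` remains one in `y`.
    below-apart-allowed : ∀ {x y} → Allowed x → ¬ N ~[ x ] L → y ≤ᴺ x → Allowed y
    below-apart-allowed {x} {y} (_ , x-⊤) N≁L y≤x = (λ N~L _ → contradiction (y≤x N N~L) N≁L) , y-⊤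
      where
      y-⊤ : Good y ⊤ᴺ
      y-⊤ N~L _ with b , b~N , b< ← x-⊤ N~L N≁L = b , b~N , λ {c} c~N → b< (y≤x c c~N)

  abstract
    ⊥ᴺ-allowed : Allowed ⊥ᴺ
    ⊥ᴺ-allowed = apart-allowed {⊥ᴺ} (λ N~L → Finₚ.<⇒≢ N<L (⊥ᴺ-≡ N~L)) (λ 0~N → Finₚ.<⇒≢ 0<N (⊥ᴺ-≡ 0~N))

  abstract
    pair-allowed : ∀ {i j} → N ≢ i → N ≢ j → Allowed (pair i j)
    pair-allowed {i} {j} N≢i N≢j = apart-allowed {pair i j}
      (λ N~L → Finₚ.<⇒≢ N<L (sym (pair-isolated i j N≢i N≢j (symmetric (pair i j) N~L))))
      (λ 0~N → Finₚ.<⇒≢ 0<N (pair-isolated i j N≢i N≢j 0~N))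

  abstract
    triple-allowed : ∀ {d} → d Fin.< N → Allowed (triple d)
    triple-allowed {d} d<N =
      (λ _ _ → d , triple-d~N d , λ {c} c~N → subst (d Fin.<_) (sym (⊥ᴺ-≡ c~N)) d<N) ,
      nonsingleton-good {triple d} {⊤ᴺ} (⊤ᴺ-maximum (triple d)) (triple-d~L d) (ℕₚ.<-trans d<N N<L)

  abstract
    cut-allowed : ∀ {e} → e Fin.< N → Allowed (cut e)
    cut-allowed {e} e<N = apart-allowed {cut e} (cut-N≁L e e<N)
      (λ 0~N → contradiction (proj₁ (cut⁻ e {N} {zero} (symmetric (cut e) 0~N) (e<N , N<L))) λ ())

-- Automorphisms

module Vertices (k : ℕ) where
  open Chains k
  open PFOrder k
  open Shapes k
  Vertex : Set
  Vertex = Σ Element (OnPFChain n)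

  vertex : ∀ x → Allowed x → Vertex
  vertex x allowed = x , allowed⇒onPFChain allowed

  allowed : (X : Vertex) → Allowed (proj₁ X)
  allowed (x , on) = onPFChain⇒allowed on

  infix 4 _≼_ _≋_

  record _≼_ (X Y : Vertex) : Set where
    constructor mk≼
    field
      refines : proj₁ X ≤ᴺ proj₁ Y
      good    : Good (proj₁ X) (proj₁ Y)

  open _≼_

  ≼⇒Star : ∀ {X Y} → X ≼ Y → Star (PFCover n) (proj₁ X) (proj₁ Y)
  ≼⇒Star {X} {Y} (mk≼ x≤y good) = good⇒PFCover* (allowed X) (allowed Y) x≤y good

  Star⇒≼ : ∀ {X Y : Vertex} → Star (PFCover n) (proj₁ X) (proj₁ Y) → X ≼ Y
  Star⇒≼ p = mk≼ (PFCover*⇒≤ᴺ p) (PFCover*⇒good p)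

  ≼-reflexive : ∀ {X Y : Vertex} → proj₁ X ≡ proj₁ Y → X ≼ Y
  ≼-reflexive refl = mk≼ (λ _ a~b → a~b) (λ N~L N≁L → contradiction N~L N≁L)

  ≼-trans : ∀ {X Y Z} → X ≼ Y → Y ≼ Z → X ≼ Z
  ≼-trans {X} {Y} {Z} (mk≼ x≤y xy) (mk≼ y≤z yz) =
    mk≼ (λ a a~b → y≤z a (x≤y a a~b)) (good-trans {proj₁ X} {proj₁ Y} {proj₁ Z} x≤y y≤z xy yz)

  _≋_ : Rel Vertex 0ℓ
  X ≋ Y = X ≼ Y × Y ≼ X

  ≋-sym : ∀ {X Y} → X ≋ Y → Y ≋ X
  ≋-sym (p , q) = q , p

  ≋-trans : ∀ {X Y Z} → X ≋ Y → Y ≋ Z → X ≋ Z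
  ≋-trans (p , q) (p′ , q′) = ≼-trans p p′ , ≼-trans q′ q

  Avoids : Pred Vertex 0ℓ
  Avoids (x , _) = ¬ N ~[ x ] L

  avoids-≼ : ∀ {X Y} → Avoids Y → proj₁ X ≤ᴺ proj₁ Y → X ≼ Y
  avoids-≼ N≁L x≤y = mk≼ x≤y λ N~L _ → contradiction N~L N≁L

  nonsingleton-≼ : ∀ {X Y} → proj₁ X ≤ᴺ proj₁ Y → ∀ {b} → b ~[ proj₁ X ] L → b Fin.< L → X ≼ Y
  nonsingleton-≼ {X} {Y} x≤y b~L b<L = mk≼ x≤y (nonsingleton-good {proj₁ X} {proj₁ Y} x≤y b~L b<L)

  IsBottom : Pred Vertex 0ℓ
  IsBottom Y = ∀ Z → Y ≼ Z

  abstract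
    discrete⇒bottom : ∀ {Y} → (∀ {a b} → a ~[ proj₁ Y ] b → a ≡ b) → IsBottom Y
    discrete⇒bottom {Y} discrete Z = ≼-trans {Y = vertex ⊥ᴺ ⊥ᴺ-allowed}
      (≼-reflexive (≤ᴺ-antisym (λ a a~b → subst (a ~[ ⊥ᴺ ]_) (discrete a~b) (reflexive ⊥ᴺ)) (⊥ᴺ-minimum (proj₁ Y))))
      (mk≼ (⊥ᴺ-minimum (proj₁ Z)) (proj₁ (allowed Z)))

  bottom⇒discrete : ∀ {Y} → IsBottom Y → ∀ {a b} → a ~[ proj₁ Y ] b → a ≡ b
  bottom⇒discrete bottom {a} a~b = ⊥ᴺ-≡ (refines (bottom (vertex ⊥ᴺ ⊥ᴺ-allowed)) a a~b)

  abstract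
    ¬bottom⇒pair : ∀ {Y} → ¬ IsBottom Y → ∃₂ λ i j → i Fin.< j × i ~[ proj₁ Y ] j
    ¬bottom⇒pair {Y@(y , _)} ¬bottom =
      decidable-stable (Finₚ.any? (λ i → Finₚ.any? (λ j → (i Finₚ.<? j) ×-dec (i ~[ y ]? j))))
        λ none → ¬bottom (discrete⇒bottom {Y} (discrete none))
      where
      discrete : ¬ (∃₂ λ i j → i Fin.< j × i ~[ y ] j) → ∀ {a b} → a ~[ y ] b → a ≡ b
      discrete none {a} {b} a~b with Finₚ.<-cmp a b
      ... | tri< a<b _ _ = contradiction (a , b , a<b , a~b) none
      ... | tri≈ _ a≡b _ = a≡b
      ... | tri> _ _ b<a = contradiction (b , a , b<a , symmetric y a~b) none

  short-N-isolated : ∀ {d b} → d Fin.< N → b ~[ pair d L ] N → b ≡ N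
  short-N-isolated {d} d<N = pair-isolated d L (Finₚ.<⇒≢ d<N ∘ sym) (Finₚ.<⇒≢ N<L)

  short-N≁L : ∀ {d} → d Fin.< N → ¬ N ~[ pair d L ] L
  short-N≁L {d} d<N N~L = Finₚ.<⇒≢ N<L (sym (short-N-isolated d<N (symmetric (pair d L) N~L)))

  -- The partitions s_d and t_d.
  Short Long : ∀ {d} → d Fin.< N → Vertex
  Short {d} d<N = vertex (pair d L) (apart-allowed {pair d L} (short-N≁L d<N) (Finₚ.<⇒≢ 0<N ∘ short-N-isolated d<N))
  Long  {d} d<N = vertex (triple d) (triple-allowed d<N)

  Cut : ∀ {e} → e Fin.< N → Vertex
  Cut {e} e<N = vertex (cut e) (cut-allowed e<N)

  <N⇒<L : ∀ {d : Fin (suc n)} → d Fin.< N → d Fin.< L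
  <N⇒<L d<N = ℕₚ.<-trans d<N N<L

  <L⇒<N : ∀ {a : Fin (suc n)} → a Fin.< L → a ≢ N → a Fin.< N
  <L⇒<N a<L a≢N = Finₚ.≤∧≢⇒< (<L⇒≤N a<L) a≢N

  short≼ : ∀ {d} (d<N : d Fin.< N) {X} → d ~[ proj₁ X ] L → Short d<N ≼ X
  short≼ {d} d<N {X} d~L = nonsingleton-≼ {Short d<N} {X} (pair≤ d L {proj₁ X} d~L) (pair-~ d L) (<N⇒<L d<N)

  short≼⁻ : ∀ {d} {d<N : d Fin.< N} {X} → Short d<N ≼ X → d ~[ proj₁ X ] L
  short≼⁻ {d} s≼X = refines s≼X d (pair-~ d L)

  long≼ : ∀ {d} (d<N : d Fin.< N) {X} → d ~[ proj₁ X ] N → N ~[ proj₁ X ] L → Long d<N ≼ X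
  long≼ {d} d<N {X} d~N N~L = nonsingleton-≼ {Long d<N} {X} (triple≤ d {proj₁ X} d~N N~L) (triple-d~L d) (<N⇒<L d<N)

  -- At the bottom the block of `N` is a singleton, so `Good` from the bottom asks for an element
  -- below `N` itself. In particular {N, L} is never a block of a vertex.
  N~L⇒below : ∀ {X} → N ~[ proj₁ X ] L → ∃ λ b → b Fin.< N × b ~[ proj₁ X ] N
  N~L⇒below {X} N~L = let (b , b~N , b<) = proj₁ (allowed X) N~L (λ N~L → Finₚ.<⇒≢ N<L (⊥ᴺ-≡ N~L)) in
    b , b< (reflexive ⊥ᴺ) , b~N

  -- Exactly A and the bottom of the poset are strictly below U.
  record Special (A U : Vertex) : Set where
    field
      A-not-bottom : ¬ IsBottom A
      A≼U          : A ≼ U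
      U⋠A          : ¬ U ≼ A
      trichotomy   : ∀ {Y} → Y ≼ U → U ≼ Y ⊎ Y ≋ A ⊎ IsBottom Y

  abstract
    -- Of the proper nontrivial refinements of the triple, {N, L} is not a vertex, and {d, N} is not
    -- below `Long` because the triple has no element under `d`. Only {d, L} remains.
    short-long-special : ∀ {d} (d<N : d Fin.< N) → Special (Short d<N) (Long d<N)
    short-long-special {d} d<N = record
      { A-not-bottom = λ bottom → Finₚ.<⇒≢ (<N⇒<L d<N) (bottom⇒discrete bottom (pair-~ d L))
      ; A≼U          = short≼ d<N {Long d<N} (triple-d~L d)
      ; U⋠A          = λ U≼A → short-N≁L d<N (refines U≼A N (triple-N~L d))
      ; trichotomy   = trichotomy
      }
      where
      trichotomy : ∀ {Y} → Y ≼ Long d<N → Long d<N ≼ Y ⊎ Y ≋ Short d<N ⊎ IsBottom Y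
      trichotomy {Y@(y , _)} Y≼U = by-cases (N ~[ y ]? L) (d ~[ y ]? L)
        where
        discrete : ¬ N ~[ y ] L → ¬ d ~[ y ] L → ∀ {a b} → a ~[ y ] b → a ≡ b
        discrete N≁L d≁L {a} {b} a~b = decidable-stable (a Finₚ.≟ b) λ a≢b →
          d≁L (pair-atom d L {y} (below-triple d {y} (refines Y≼U) d≁N N≁L) a≢b a~b d (pair-~ d L))
          where
          d≁N : ¬ d ~[ y ] N
          d≁N d~N = let (b , b~N , b<) = good Y≼U (triple-N~L d) N≁L in
            Finₚ.<⇒≢ (b< d~N) (triple-below-N d (b< (reflexive y)) b~N)
        by-cases : Dec (N ~[ y ] L) → Dec (d ~[ y ] L) → Long d<N ≼ Y ⊎ Y ≋ Short d<N ⊎ IsBottom Y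
        by-cases (yes N~L) _ = let (b , b<N , b~N) = N~L⇒below {Y} N~L in
          inj₁ (long≼ d<N {Y} (subst (_~[ y ] N) (triple-below-N d b<N (refines Y≼U b b~N)) b~N) N~L)
        by-cases (no N≁L) (yes d~L) = inj₂ (inj₁ (avoids-≼ {Y} {Short d<N} (short-N≁L d<N)
            (below-triple d {y} (refines Y≼U) (λ d~N → N≁L (transitive y (symmetric y d~N) d~L)) N≁L) ,
          short≼ d<N {Y} d~L))
        by-cases (no N≁L) (no d≁L) = inj₂ (inj₂ (discrete⇒bottom {Y} (discrete N≁L d≁L)))

  abstract
    -- If `U` joins `N` and `L`, it has some `Long` and the corresponding `Short` below it, and the
    -- trichotomy leaves them no choice. Otherwise every related pair of `U` spans a vertex below
    -- `U`; whether that vertex is `A`, the bottom or `U` itself, the pair is related in `A`, so `U`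
    -- would lie below `A`.
    special⇒short-long : ∀ {A U} → Special A U → ∃₂ λ d (d<N : d Fin.< N) → A ≋ Short d<N × U ≋ Long d<N
    special⇒short-long {A@(a , _)} {U@(u , _)} special = by-cases (N ~[ u ]? L)
      where
      open Special special
      module Joined (N~L : N ~[ u ] L) {b} (b<N : b Fin.< N) (b~N : b ~[ u ] N) where
        S T : Vertex
        S = Short b<N
        T = Long b<N
        module ST = Special (short-long-special b<N)
        T≼U : T ≼ U
        T≼U = long≼ b<N {U} b~N N~L
        S≋A : S ≋ A
        S≋A = conclude (trichotomy (≼-trans {Y = T} ST.A≼U T≼U))
          where
          conclude : U ≼ S ⊎ S ≋ A ⊎ IsBottom S → S ≋ A
          conclude (inj₁ U≼S)             = contradiction (≼-trans {Y = U} T≼U U≼S) ST.U⋠A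
          conclude (inj₂ (inj₁ S≋A))      = S≋A
          conclude (inj₂ (inj₂ S-bottom)) = contradiction S-bottom ST.A-not-bottom
        U≼T : U ≼ T
        U≼T = conclude (trichotomy T≼U)
          where
          conclude : U ≼ T ⊎ T ≋ A ⊎ IsBottom T → U ≼ T
          conclude (inj₁ U≼T)             = U≼T
          conclude (inj₂ (inj₁ T≋A))      = contradiction (≼-trans {Y = A} (proj₁ T≋A) (proj₂ S≋A)) ST.U⋠A
          conclude (inj₂ (inj₂ T-bottom)) = contradiction (T-bottom S) ST.U⋠A
      module Separate (N≁L : ¬ N ~[ u ] L) where
        pairᵁ : ∀ i j → i ~[ u ] j → Vertex
        pairᵁ i j i~j = vertex (pair i j) (below-apart-allowed {u} {pair i j} (allowed U) N≁L (pair≤ i j {u} i~j))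
        pairᵁ≼U : ∀ {i j} (i~j : i ~[ u ] j) → pairᵁ i j i~j ≼ U
        pairᵁ≼U {i} {j} i~j = avoids-≼ {pairᵁ i j i~j} {U} N≁L (pair≤ i j {u} i~j)
        A-avoids : Avoids A
        A-avoids N~L = N≁L (refines A≼U N N~L)
        U≼A : ∀ {i j} → i Fin.< j → i ~[ a ] j → U ≼ A
        U≼A {i} {j} i<j i~j = avoids-≼ {U} {A} A-avoids u≤a
          where
          u≤a : u ≤ᴺ a
          u≤a c {d} c~d = conclude (trichotomy {pairᵁ c d c~d} (pairᵁ≼U c~d))
            where
            Q : Vertex
            Q = pairᵁ c d c~d
            conclude : U ≼ Q ⊎ Q ≋ A ⊎ IsBottom Q → c ~[ a ] d
            conclude (inj₁ U≼Q) = pair≤ i j {a} i~j c (pair-atom c d {pair i j}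
              (pair≤ i j {pair c d} (refines U≼Q i (refines A≼U i i~j))) (Finₚ.<⇒≢ i<j) (pair-~ i j) c (pair-~ c d))
            conclude (inj₂ (inj₁ Q≋A)) = refines (proj₁ Q≋A) c (pair-~ c d)
            conclude (inj₂ (inj₂ Q-bottom)) =
              subst (c ~[ a ]_) (bottom⇒discrete {Q} Q-bottom (pair-~ c d)) (reflexive a)
      by-cases : Dec (N ~[ u ] L) → ∃₂ λ d (d<N : d Fin.< N) → A ≋ Short d<N × U ≋ Long d<N
      by-cases (yes N~L) = let (b , b<N , b~N) = N~L⇒below {U} N~L in
        b , b<N , ≋-sym {Short b<N} {A} (Joined.S≋A N~L b<N b~N) , (Joined.U≼T N~L b<N b~N , Joined.T≼U N~L b<N b~N)
      by-cases (no N≁L) = let (i , j , i<j , i~j) = ¬bottom⇒pair {A} A-not-bottom in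
        contradiction (Separate.U≼A N≁L i<j i~j) U⋠A

-- What an automorphism preserves: special pairs, short vertices and cuts

module Invariants (k : ℕ) where
  open Chains k
  open PFOrder k
  open Shapes k
  open Vertices k
  open _≼_
  -- Carrying the inverse as data makes the notion symmetric: an inequality proved for all
  -- automorphisms can be applied to `g` and yields the opposite one.
  record Automorphism : Set where
    field
      f g    : Vertex → Vertex
      f-mono : ∀ {X Y} → X ≼ Y → f X ≼ f Y
      g-mono : ∀ {X Y} → X ≼ Y → g X ≼ g Y
      f∘g    : ∀ Y → f (g Y) ≋ Y
      g∘f    : ∀ X → g (f X) ≋ X

    f-cong : ∀ {X Y} → X ≋ Y → f X ≋ f Y
    f-cong (p , q) = f-mono p , f-mono q

    f≼⇒≼g : ∀ {X Y} → f X ≼ Y → X ≼ g Y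
    f≼⇒≼g {X} fX≼Y = ≼-trans (proj₂ (g∘f X)) (g-mono fX≼Y)

    ≼f⇒g≼ : ∀ {X Y} → Y ≼ f X → g Y ≼ X
    ≼f⇒g≼ {X} Y≼fX = ≼-trans (g-mono Y≼fX) (proj₁ (g∘f X))

    g≼⇒≼f : ∀ {X Y} → g Y ≼ X → Y ≼ f X
    g≼⇒≼f {Y = Y} gY≼X = ≼-trans (proj₂ (f∘g Y)) (f-mono gY≼X)

    ≼g⇒f≼ : ∀ {X Y} → X ≼ g Y → f X ≼ Y
    ≼g⇒f≼ {Y = Y} X≼gY = ≼-trans (f-mono X≼gY) (proj₁ (f∘g Y))

    f-cancel : ∀ {X Y} → f X ≼ f Y → X ≼ Y
    f-cancel {Y = Y} fX≼fY = ≼-trans (f≼⇒≼g fX≼fY) (proj₁ (g∘f Y))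

    f-bottom : ∀ {X} → IsBottom X → IsBottom (f X)
    f-bottom bottom Z = ≼g⇒f≼ (bottom (g Z))

    f-bottom⁻ : ∀ {X} → IsBottom (f X) → IsBottom X
    f-bottom⁻ bottom Z = f-cancel (bottom (f Z))

    f-special : ∀ {A U} → Special A U → Special (f A) (f U)
    f-special {A} {U} special = record
      { A-not-bottom = A-not-bottom ∘ f-bottom⁻
      ; A≼U          = f-mono A≼U
      ; U⋠A          = U⋠A ∘ f-cancel
      ; trichotomy   = f-trichotomy
      }
      where
      open Special special
      f-trichotomy : ∀ {Y} → Y ≼ f U → f U ≼ Y ⊎ Y ≋ f A ⊎ IsBottom Y
      f-trichotomy {Y} Y≼fU with trichotomy (≼f⇒g≼ Y≼fU)
      ... | inj₁ U≼gY               = inj₁ (≼g⇒f≼ U≼gY)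
      ... | inj₂ (inj₁ (gY≼A , A≼gY)) = inj₂ (inj₁ (g≼⇒≼f gY≼A , ≼g⇒f≼ A≼gY))
      ... | inj₂ (inj₂ gY-bottom)   = inj₂ (inj₂ λ Z → ≼-trans (proj₂ (f∘g Y)) (f-bottom gY-bottom Z))

    f-N~L : ∀ {X} → N ~[ proj₁ X ] L → N ~[ proj₁ (f X) ] L
    f-N~L {X} N~L =
      let (b , b<N , b~N) = N~L⇒below {X} N~L
          (e , e<N , _ , (_ , T≼fT)) = special⇒short-long (f-special (short-long-special b<N))
      in refines (≼-trans {Y = f (Long b<N)} T≼fT (f-mono (long≼ b<N {X} b~N N~L))) N (triple-N~L e)

  inverse : Automorphism → Automorphism
  inverse F = record { f = g ; g = f ; f-mono = g-mono ; g-mono = f-mono ; f∘g = g∘f ; g∘f = f∘g }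
    where open Automorphism F

  -- Dominated (Short d) (Short e) expresses d ≤ e in terms of ≼ and Avoids only.
  Dominated : Rel Vertex 0ℓ
  Dominated A B = ∀ X → Avoids X → B ≼ X → ∃ λ X′ → Avoids X′ × X ≼ X′ × A ≼ X′

  dominated-resp : ∀ {A A′ B B′} → A′ ≼ A → B ≼ B′ → Dominated A B → Dominated A′ B′
  dominated-resp A′≼A B≼B′ dominated X avoids B′≼X
    with X′ , avoids′ , X≼X′ , A≼X′ ← dominated X avoids (≼-trans B≼B′ B′≼X) =
    X′ , avoids′ , X≼X′ , ≼-trans A′≼A A≼X′

  outer-~L : ∀ {d e : Fin (suc n)} → d Fin.≤ e → d ~[ cut e ] L
  outer-~L {d} {e} d≤e = cut⁺ e (λ (e<d , _) → contradiction d≤e (ℕₚ.<⇒≱ e<d))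
    (λ (_ , L<L) → contradiction L<L (ℕₚ.<-irrefl refl))

  inner-≁L : ∀ {d e : Fin (suc n)} → e Fin.< d → d Fin.< L → ¬ d ~[ cut e ] L
  inner-≁L {d} {e} e<d d<L d~L = ℕₚ.<-irrefl refl (proj₂ (cut⁻ e d~L (e<d , d<L)))

  -- A block joining an inner `a` to some `b` below `e` would cross the chord from `e` to `L` and
  -- thereby put `a` into the block of `L`, which the last hypothesis rules out.
  ≼cut : ∀ {e} (e<N : e Fin.< N) {X} → Avoids X → e ~[ proj₁ X ] L →
         (∀ {d} → e Fin.< d → d Fin.< N → ¬ d ~[ proj₁ X ] L) → X ≼ Cut e<N
  ≼cut {e} e<N {X@(x , _)} avoids e~L none = avoids-≼ {X} {Cut e<N} (cut-N≁L e e<N)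
    λ a {b} a~b → cut⁺ e (inner-~ a~b) (inner-~ (symmetric x a~b))
    where
    inner≁L : ∀ {a} → Inner e a → ¬ a ~[ x ] L
    inner≁L {a} (e<a , a<L) a~L = none e<a (<L⇒<N a<L (λ { refl → avoids a~L })) a~L
    inner-~ : ∀ {a b} → a ~[ x ] b → Inner e a → Inner e b
    inner-~ {a} {b} a~b ia@(e<a , a<L) with Finₚ.<-cmp e b | <L-or-≡L b
    ... | tri< e<b _ _  | inj₁ b<L  = e<b , b<L
    ... | tri< _ _ _    | inj₂ refl = contradiction a~b (inner≁L ia)
    ... | tri≈ _ refl _ | _         = contradiction (transitive x a~b e~L) (inner≁L ia)
    ... | tri> _ _ b<e  | _         = contradiction
      (transitive x a~b (transitive x (uncrossed x b<e e<a a<L (symmetric x a~b) e~L) e~L)) (inner≁L ia)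

  -- The block of `L` in `X` may reach beyond `e`, so the cut is made at its largest element `c`
  -- below `N`; the outer block of that cut still contains `d`.
  ≤⇒dominated : ∀ {d e} (d<N : d Fin.< N) (e<N : e Fin.< N) → d Fin.≤ e → Dominated (Short d<N) (Short e<N)
  ≤⇒dominated {d} {e} d<N e<N d≤e X@(x , _) avoids S≼X
    with greatest (λ a → (a ~[ x ]? L) ×-dec (a Finₚ.<? N)) (e , short≼⁻ {d<N = e<N} {X} S≼X , e<N)
  ... | c , (c~L , c<N) , ≤c = Cut c<N , cut-N≁L c c<N ,
    ≼cut c<N {X} avoids c~L (λ c<a a<N a~L → ℕₚ.<⇒≱ c<a (≤c (a~L , a<N))) ,
    short≼ d<N {Cut c<N} (outer-~L (ℕₚ.≤-trans d≤e (≤c (short≼⁻ {d<N = e<N} {X} S≼X , e<N))))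

  -- The test case is `Cut e<N`: were `e` below `d`, the cut would relate `d` to `N`, and a
  -- coarsening that also relates `d` to `L` would join `N` and `L`.
  dominated⇒≤ : ∀ {d e} (d<N : d Fin.< N) (e<N : e Fin.< N) → Dominated (Short d<N) (Short e<N) → d Fin.≤ e
  dominated⇒≤ {d} {e} d<N e<N dominated
    with dominated (Cut e<N) (cut-N≁L e e<N) (short≼ e<N {Cut e<N} (outer-~L {e} {e} ℕₚ.≤-refl))
  ... | X@(x , _) , avoids , C≼X , S≼X = ℕₚ.≮⇒≥ λ e<d → avoids (transitive x
    (refines C≼X N (cut⁺ e {N} {d} (λ _ → e<d , <N⇒<L d<N) (λ _ → e<N , N<L)))
    (short≼⁻ {d<N = d<N} {X} S≼X))

  module _ (F : Automorphism) where
    open Automorphism F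
    private
      module G = Automorphism (inverse F)

    f-avoids : ∀ {X} → Avoids X → Avoids (f X)
    f-avoids {X} avoids N~L = avoids (refines (proj₁ (g∘f X)) N (G.f-N~L {f X} N~L))

    g-avoids : ∀ {X} → Avoids X → Avoids (g X)
    g-avoids {X} avoids N~L = avoids (refines (proj₁ (f∘g X)) N (f-N~L {g X} N~L))

    f-dominated⁻ : ∀ {A B} → Dominated (f A) (f B) → Dominated A B
    f-dominated⁻ {A} {B} dominated X avoids B≼X =
      let (X′ , avoids′ , fX≼X′ , fA≼X′) = dominated (f X) (f-avoids {X} avoids) (f-mono B≼X) in
      g X′ , g-avoids {X′} avoids′ , f≼⇒≼g fX≼X′ , f≼⇒≼g fA≼X′

    f-short : ∀ {d} (d<N : d Fin.< N) → ∃₂ λ e (e<N : e Fin.< N) → f (Short d<N) ≋ Short e<N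
    f-short d<N = let (e , e<N , S≋ , _) = special⇒short-long (f-special (short-long-special d<N)) in
      e , e<N , S≋

    -- `Dominated` compares indices and is reflected by `f`, so the induced map on indices is
    -- strictly increasing, and such a map never lowers an index. The recursion runs over `toℕ d`
    -- because the predecessor `inject₁ d` is not a subterm of `suc d`.
    f-short-≥ : ∀ {d e} (d<N : d Fin.< N) (e<N : e Fin.< N) → f (Short d<N) ≋ Short e<N → d Fin.≤ e
    f-short-≥ {d} d<N e<N fS≋ = go (toℕ d) refl d<N e<N fS≋
      where
      go : ∀ j {d e} → toℕ d ≡ j → (d<N : d Fin.< N) (e<N : e Fin.< N) → f (Short d<N) ≋ Short e<N → d Fin.≤ e
      go zero d≡j _ _ _ = ℕₚ.≤-trans (ℕₚ.≤-reflexive d≡j) z≤n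
      go (suc j) {suc d} {e} d≡j d<N e<N fS≋ = ℕₚ.≤-<-trans
        (ℕₚ.≤-trans (ℕₚ.≤-reflexive (sym (Finₚ.toℕ-inject₁ d)))
          (go j (trans (Finₚ.toℕ-inject₁ d) (ℕₚ.suc-injective d≡j)) c<N c′<N fS′≋)) c′<e
        where
        c<d : inject₁ d Fin.< suc d
        c<d = ℕₚ.≤-reflexive (cong suc (Finₚ.toℕ-inject₁ d))
        c<N : inject₁ d Fin.< N
        c<N = ℕₚ.<-trans c<d d<N
        image = f-short c<N
        c′    = proj₁ image
        c′<N  = proj₁ (proj₂ image)
        fS′≋  = proj₂ (proj₂ image)
        c′<e : c′ Fin.< e
        c′<e = ℕₚ.≰⇒> λ e≤c′ → ℕₚ.<⇒≱ c<d
          (dominated⇒≤ d<N c<N (f-dominated⁻ (dominated-resp (proj₁ fS≋) (proj₂ fS′≋) (≤⇒dominated e<N c′<N e≤c′))))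

  module _ (F : Automorphism) where
    open Automorphism F
    private
      G = inverse F

    f-short-fixed : ∀ {d} (d<N : d Fin.< N) → f (Short d<N) ≋ Short d<N
    f-short-fixed {d} d<N = let (e , e<N , fS≋) = f-short F d<N in fixed e<N fS≋
      where
      fixed : ∀ {e} (e<N : e Fin.< N) → f (Short d<N) ≋ Short e<N → f (Short d<N) ≋ Short d<N
      fixed {e} e<N fS≋ = ≋-trans {Y = Short e<N} fS≋ (S≋ e≡d)
        where
        gS≋ : g (Short e<N) ≋ Short d<N
        gS≋ = ≋-trans {Y = g (f (Short d<N))} (g-mono (proj₂ fS≋) , g-mono (proj₁ fS≋)) (g∘f (Short d<N))
        e≡d : e ≡ d
        e≡d = Finₚ.≤-antisym (f-short-≥ G e<N d<N gS≋) (f-short-≥ F d<N e<N fS≋)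
        S≋ : e ≡ d → Short e<N ≋ Short d<N
        S≋ refl = ≼-reflexive refl , ≼-reflexive refl

    f-cut≼ : ∀ {e} (e<N : e Fin.< N) → f (Cut e<N) ≼ Cut e<N
    f-cut≼ {e} e<N = ≼cut e<N {f C} (f-avoids F {C} (cut-N≁L e e<N))
      (short≼⁻ {d<N = e<N} {f C} (≼-trans (proj₂ (f-short-fixed e<N)) (f-mono (short≼ e<N {C} (outer-~L {e} {e} ℕₚ.≤-refl)))))
      (λ {d} e<d d<N d~L → inner-≁L e<d (<N⇒<L d<N)
        (short≼⁻ {d<N = d<N} {C} (f-cancel (≼-trans (proj₁ (f-short-fixed d<N)) (short≼ d<N {f C} d~L)))))
      where
      C = Cut e<N

  Pairᵛ : ∀ {i j} → Allowed (pair i j) → Vertex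
  Pairᵛ {i} {j} = vertex (pair i j)

  pair≼cut⁻ : ∀ {i j e} {al : Allowed (pair i j)} (e<N : e Fin.< N) → i Fin.< j → j Fin.< L →
              ¬ Pairᵛ al ≼ Cut e<N → i Fin.≤ e × e Fin.< j
  pair≼cut⁻ {i} {j} {e} {al} e<N i<j j<L P⋠C with e Finₚ.<? i | e Finₚ.<? j
  ... | no e≮i | yes e<j = ℕₚ.≮⇒≥ e≮i , e<j
  ... | yes e<i | _ = contradiction (avoids-≼ {Pairᵛ al} {Cut e<N} (cut-N≁L e e<N)
    (pair≤ i j {cut e} (cut⁺ e (λ _ → ℕₚ.<-trans e<i i<j , j<L) (λ _ → e<i , ℕₚ.<-trans i<j j<L)))) P⋠C
  ... | no e≮i | no e≮j = contradiction (avoids-≼ {Pairᵛ al} {Cut e<N} (cut-N≁L e e<N)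
    (pair≤ i j {cut e} (cut⁺ e (λ (e<i , _) → contradiction e<i e≮i) (λ (e<j , _) → contradiction e<j e≮j)))) P⋠C

  pair⋠cut : ∀ {i j e} {al : Allowed (pair i j)} (e<N : e Fin.< N) → j Fin.< L →
             i Fin.≤ e → e Fin.< j → ¬ Pairᵛ al ≼ Cut e<N
  pair⋠cut {i} {j} {e} e<N j<L i≤e e<j P≼C = ℕₚ.<⇒≱
    (proj₁ (cut⁻ e (symmetric (cut e) (refines P≼C i (pair-~ i j))) (e<j , j<L))) i≤e

  module _ (F : Automorphism) where
    open Automorphism F
    private
      G = inverse F

    -- If the image pair were below the cut at `e`, then applying `g`, which sends the cut below
    -- itself, would put the original pair below that cut too.
    separated : ∀ {i j i′ j′} (al : Allowed (pair i j)) (al′ : Allowed (pair i′ j′)) →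
                f (Pairᵛ al) ≋ Pairᵛ al′ → i′ Fin.< j′ → j Fin.< L → j′ Fin.< L →
                ∀ {e} → e Fin.< N → i Fin.≤ e → e Fin.< j → i′ Fin.≤ e × e Fin.< j′
    separated al al′ fP≋Q i′<j′ j<L j′<L e<N i≤e e<j = pair≼cut⁻ {al = al′} e<N i′<j′ j′<L λ Q≼C →
      pair⋠cut {al = al} e<N j<L i≤e e<j (≼-trans (f≼⇒≼g (≼-trans (proj₁ fP≋Q) Q≼C)) (f-cut≼ G e<N))

-- Fixed atoms and the identity of automorphisms

module Rigidity (k : ℕ) where
  open Chains k
  open PFOrder k
  open Shapes k
  open Vertices k
  open Invariants k
  open _≼_
  module _ (F : Automorphism) where
    open Automorphism F
    private
      G = inverse F

    module _ {i j} (al : Allowed (pair i j)) (i<j : i Fin.< j) (j<L : j Fin.< L) where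
      private
        P : Vertex
        P = Pairᵛ al

        L-isolated : ∀ {b} → b ~[ pair i j ] L → b ≡ L
        L-isolated = pair-isolated i j (Finₚ.<⇒≢ (ℕₚ.<-trans i<j j<L) ∘ sym) (Finₚ.<⇒≢ j<L ∘ sym)

        fP-avoids : Avoids (f P)
        fP-avoids = f-avoids F {P} (Finₚ.<⇒≢ N<L ∘ L-isolated)

      module _ {i′ j′} (i′<j′ : i′ Fin.< j′) (i′~j′ : i′ ~[ proj₁ (f P) ] j′) where
        private
          Q≤fP : pair i′ j′ ≤ᴺ proj₁ (f P)
          Q≤fP = pair≤ i′ j′ {proj₁ (f P)} i′~j′

        image-allowed : Allowed (pair i′ j′)
        image-allowed = below-apart-allowed {proj₁ (f P)} {pair i′ j′} (allowed (f P)) fP-avoids Q≤fP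

        private
          Q : Vertex
          Q = Pairᵛ image-allowed

          Q≼fP : Q ≼ f P
          Q≼fP = avoids-≼ {Q} {f P} fP-avoids Q≤fP

          pair-below-gQ : ∃₂ λ a b → a Fin.< b × a ~[ proj₁ (g Q) ] b
          pair-below-gQ = ¬bottom⇒pair {g Q} λ bottom →
            Finₚ.<⇒≢ i′<j′ (bottom⇒discrete {Q} (Automorphism.f-bottom⁻ G {Q} bottom) (pair-~ i′ j′))

          P≼gQ : P ≼ g Q
          P≼gQ = let (a , b , a<b , a~b) = pair-below-gQ in
            avoids-≼ {P} {g Q} (g-avoids F {Q} (fP-avoids ∘ Q≤fP N))
              (pair-atom i j {proj₁ (g Q)} (refines (≼f⇒g≼ {P} {Q} Q≼fP)) (Finₚ.<⇒≢ a<b) a~b)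

        -- The pair `Q` found inside `f P` pulls back to a vertex below the atom `P` that is not the
        -- bottom, hence to `P` itself; so `f P` is no larger than `Q`.
        image-≋ : f P ≋ Pairᵛ image-allowed
        image-≋ = ≼g⇒f≼ {P} {Q} P≼gQ , Q≼fP

        -- Otherwise a short vertex would lie below `f P`; short vertices are fixed, so it would lie
        -- below `P`, where `L` is isolated.
        image≢L : j′ ≢ L
        image≢L refl = Finₚ.<⇒≢ i′<j′ (L-isolated (refines S≼P i′ (pair-~ i′ L)))
          where
          i′<N : i′ Fin.< N
          i′<N = <L⇒<N i′<j′ λ i′≡N → fP-avoids (subst (_~[ proj₁ (f P) ] L) i′≡N i′~j′)
          S≼P : Short i′<N ≼ P
          S≼P = ≼-trans {Y = g (Short i′<N)} (proj₂ (f-short-fixed G i′<N))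
            (≼f⇒g≼ {P} {Short i′<N} (≼-trans {Y = Q} (≼-reflexive refl) Q≼fP))

        f-pair-fixed′ : f P ≋ P
        f-pair-fixed′ = ≋-trans image-≋ (Q≋P i≡i′ j≡j′)
          where
          j′<L : j′ Fin.< L
          j′<L = Finₚ.≤∧≢⇒< (≤L j′) image≢L
          gQ≋P : g Q ≋ P
          gQ≋P = ≋-trans {Y = g (f P)} (g-mono (proj₂ image-≋) , g-mono (proj₁ image-≋)) (g∘f P)
          P⇒Q : ∀ {e} → e Fin.< N → i Fin.≤ e → e Fin.< j → i′ Fin.≤ e × e Fin.< j′
          P⇒Q = separated F al image-allowed image-≋ i′<j′ j<L j′<L
          Q⇒P : ∀ {e} → e Fin.< N → i′ Fin.≤ e → e Fin.< j′ → i Fin.≤ e × e Fin.< j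
          Q⇒P = separated G image-allowed al gQ≋P i<j j′<L j<L
          <<N : ∀ {a b : Fin (suc n)} → a Fin.< b → b Fin.< L → a Fin.< N
          <<N a<b b<L = ℕₚ.<-≤-trans a<b (<L⇒≤N b<L)
          i≡i′ : i ≡ i′
          i≡i′ = Finₚ.≤-antisym (proj₁ (Q⇒P (<<N i′<j′ j′<L) ℕₚ.≤-refl i′<j′))
            (proj₁ (P⇒Q (<<N i<j j<L) ℕₚ.≤-refl i<j))
          -- The lower ends agree by cutting at each of them. If the upper ends differed, the cut at
          -- the smaller one would separate one pair but not the other.
          j≮j′ : ¬ j Fin.< j′
          j≮j′ j<j′ = ℕₚ.<-irrefl refl
            (proj₂ (Q⇒P (<<N j<j′ j′<L) (subst (Fin._≤ j) i≡i′ (ℕₚ.<⇒≤ i<j)) j<j′))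
          j′≮j : ¬ j′ Fin.< j
          j′≮j j′<j = ℕₚ.<-irrefl refl
            (proj₂ (P⇒Q (<<N j′<j j<L) (subst (Fin._≤ j′) (sym i≡i′) (ℕₚ.<⇒≤ i′<j′)) j′<j))
          j≡j′ : j ≡ j′
          j≡j′ = Finₚ.≤-antisym (ℕₚ.≮⇒≥ j′≮j) (ℕₚ.≮⇒≥ j≮j′)
          Q≋P : i ≡ i′ → j ≡ j′ → Q ≋ P
          Q≋P refl refl = ≼-reflexive refl , ≼-reflexive refl

    f-pair-fixed : ∀ {i j} (al : Allowed (pair i j)) → i Fin.< j → i ≢ N → f (Pairᵛ al) ≋ Pairᵛ al
    f-pair-fixed {i} {j} al i<j i≢N = [ inner , outer ]′ (<L-or-≡L j)
      where
      P : Vertex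
      P = Pairᵛ al
      inner : j Fin.< L → f P ≋ P
      inner j<L = let (_ , _ , i′<j′ , i′~j′) = pair-below in f-pair-fixed′ al i<j j<L i′<j′ i′~j′
        where
        pair-below : ∃₂ λ i′ j′ → i′ Fin.< j′ × i′ ~[ proj₁ (f P) ] j′
        pair-below = ¬bottom⇒pair {f P} λ bottom →
          Finₚ.<⇒≢ i<j (bottom⇒discrete {P} (f-bottom⁻ {P} bottom) (pair-~ i j))
      outer : j ≡ L → f P ≋ P
      outer refl = ≋-trans {Y = f S} (f-cong {P} {S} P≋S) (≋-trans {Y = S} (f-short-fixed F i<N) (≋-sym {P} {S} P≋S))
        where
        i<N : i Fin.< N
        i<N = <L⇒<N i<j i≢N
        S : Vertex
        S = Short i<N
        P≋S : P ≋ S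
        P≋S = ≼-reflexive refl , ≼-reflexive refl

    module _ (X : Vertex) where
      private
        x y : Element
        x = proj₁ X
        y = proj₁ (f X)

      f-pair-~ : ∀ {i j} (al : Allowed (pair i j)) → i Fin.< j → i ≢ N → Pairᵛ al ≼ X → i ~[ y ] j
      f-pair-~ {i} {j} al i<j i≢N P≼X = refines (≼-trans (proj₂ (f-pair-fixed al i<j i≢N)) (f-mono P≼X)) i (pair-~ i j)

      ordered-pairs : (C : Pred (Fin (suc n)) 0ℓ) → (∀ {i j} → C i → C j → i Fin.< j → i ~[ x ] j → i ~[ y ] j) →
                      ∀ {i j} → C i → C j → i ~[ x ] j → i ~[ y ] j
      ordered-pairs C H {i} {j} ci cj i~j = by-order (Finₚ.<-cmp i j)
        where
        by-order : Tri (i Fin.< j) (i ≡ j) (j Fin.< i) → i ~[ y ] j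
        by-order (tri< i<j _ _)  = H ci cj i<j i~j
        by-order (tri≈ _ i≡j _) = subst (i ~[ y ]_) i≡j (reflexive y)
        by-order (tri> _ _ j<i)  = symmetric y (H cj ci j<i (symmetric x i~j))

      extensive-avoids : Avoids X → x ≤ᴺ y
      extensive-avoids N≁L a = ordered-pairs (λ _ → ⊤) pairs tt tt
        where
        pairs : ∀ {i j} → ⊤ → ⊤ → i Fin.< j → i ~[ x ] j → i ~[ y ] j
        pairs {i} {j} _ _ i<j i~j = f-pair-~ al i<j
          (λ { refl → N≁L (subst (N ~[ x ]_) (N<⇒≡L i<j) i~j) }) (avoids-≼ {Pairᵛ al} {X} N≁L (pair≤ i j {x} i~j))
          where
          al : Allowed (pair i j)
          al = below-apart-allowed {x} {pair i j} (allowed X) N≁L (pair≤ i j {x} i~j)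

      -- A pair containing `N` may refine `X` without lying below it in the order. So `rep` replaces
      -- `N` by its companion `L`; the remaining pairs leave `N` a singleton, and any element below
      -- `N` in its block of `X` is a witness for `Good`.
      extensive-N~L : N ~[ x ] L → x ≤ᴺ y
      extensive-N~L N~L a {b} a~b = transitive y (a~rep y N~ʸL a) (transitive y
        (ordered-pairs (_≢ N) pairs (rep≢N a) (rep≢N b)
          (transitive x (symmetric x (a~rep x N~L a)) (transitive x a~b (a~rep x N~L b))))
        (symmetric y (a~rep y N~ʸL b)))
        where
        N~ʸL : N ~[ y ] L
        N~ʸL = f-N~L {X} N~L
        rep : Fin (suc n) → Fin (suc n)
        rep a with a Finₚ.≟ N
        ... | yes _ = L
        ... | no  _ = a
        rep≢N : ∀ a → rep a ≢ N
        rep≢N a with a Finₚ.≟ N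
        ... | yes _   = Finₚ.<⇒≢ N<L ∘ sym
        ... | no  a≢N = a≢N
        a~rep : ∀ z → N ~[ z ] L → ∀ a → a ~[ z ] rep a
        a~rep z N~L a with a Finₚ.≟ N
        ... | yes refl = N~L
        ... | no  _    = reflexive z
        pairs : ∀ {i j} → i ≢ N → j ≢ N → i Fin.< j → i ~[ x ] j → i ~[ y ] j
        pairs {i} {j} i≢N j≢N i<j i~j = f-pair-~ (pair-allowed (i≢N ∘ sym) (j≢N ∘ sym)) i<j i≢N
          (mk≼ (pair≤ i j {x} i~j) pair-good)
          where
          pair-good : Good (pair i j) x
          pair-good N~L _ = let (b , b<N , b~N) = N~L⇒below {X} N~L in
            b , b~N , λ {c} c~N → subst (b Fin.<_) (sym (pair-isolated i j (i≢N ∘ sym) (j≢N ∘ sym) c~N)) b<N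

      extensive : x ≤ᴺ y
      extensive = by-cases (N ~[ x ]? L)
        where
        by-cases : Dec (N ~[ x ] L) → x ≤ᴺ y
        by-cases (yes N~L) = extensive-N~L N~L
        by-cases (no  N≁L) = extensive-avoids N≁L

  -- Extensivity of the inverse at `f X` supplies the opposite refinement.
  rigid : (F : Automorphism) → ∀ X → proj₁ (Automorphism.f F X) ≡ proj₁ X
  rigid F X = ≤ᴺ-antisym
    (λ a a~b → refines (proj₁ (g∘f X)) a (extensive (inverse F) (f X) a a~b))
    (extensive F X)
    where open Automorphism F

  automorphism : ∀ {f} → IsAutomorphism (PosetPFₙₙ n) f → Automorphism
  automorphism {f} isAutomorphism = record
    { f      = f
    ; g      = g
    ; f-mono = f-mono
    ; g-mono = λ {X} {Y} X≼Y → f-reflects (≼-trans (≼-reflexive (fg X)) (≼-trans X≼Y (≼-reflexive (sym (fg Y)))))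
    ; f∘g    = λ Y → ≼-reflexive (fg Y) , ≼-reflexive (sym (fg Y))
    ; g∘f    = λ X → f-reflects (≼-reflexive (fg (f X))) , f-reflects (≼-reflexive (sym (fg (f X))))
    }
    where
    open IsOrderIsomorphism isAutomorphism
    g : Vertex → Vertex
    g Y = proj₁ (surjective Y)
    fg : ∀ Y → proj₁ (f (g Y)) ≡ proj₁ Y
    fg Y = proj₂ (surjective Y) refl
    f-mono : ∀ {X Y} → X ≼ Y → f X ≼ f Y
    f-mono X≼Y = Star⇒≼ (mono (≼⇒Star X≼Y))
    f-reflects : ∀ {X Y} → f X ≼ f Y → X ≼ Y
    f-reflects fX≼fY = Star⇒≼ (cancel (≼⇒Star fX≼fY))

theorem2p8 : (n : ℕ) → 2 ≤ n →
    IsAutomorphism (PosetPFₙₙ n) id ×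
    (∀ f → IsAutomorphism (PosetPFₙₙ n) f → ∀ x → Poset._≈_ (PosetPFₙₙ n) (f x) x)
theorem2p8 (suc (suc k)) _ =
  record
    { isOrderMonomorphism = record
      { isOrderHomomorphism = record { cong = id ; mono = id }
      ; injective           = id
      ; cancel              = id
      }
    ; surjective = λ x → x , id
    } ,
  λ f isAutomorphism → Rigidity.rigid k (Rigidity.automorphism k isAutomorphism)
theorem2p8 (suc zero) (s≤s ())
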